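{- Let $\ell$ and $m$ be positive integers with $3\nmid\ell$, write $q:=2^m$, and let $a\in\mathbb{F}_q\setminus\mathbb{F}_2$ satisfy $\mathrm{Tr}(1/a)=\mathrm{Tr}(1)$. Let $\Gamma_\ell$ be the set of roots in $\mathbb{F}_{q^3}$ of $X^{2q^\ell+1}+X+a$. Pick $\omega\in\mathbb{F}_4\setminus\mathbb{F}_2$ and $b\in\mathbb{F}_q$ with $b^2+b=a^{ -1}+1$. Then $b\notin\mathbb{F}_4$. Put $c:=(b+\omega)/(b+\omega^2)$ and define $\Lambda_0:=\{v+v^{ -1}: v\in\mathbb{F}_{q^6},\ v^3=c\}$, $\Lambda_1:=\{(a^{ -1}+v+v^{ -1})/b^2: v\in\mathbb{F}_{q^6},\ v^3=\omega c\}$, $\Lambda_2:=\{(a^{ -1}+v+v^{ -1})/(b^2+1): v\in\mathbb{F}_{q^6},\ v^3=\omega^2 c\}$, and $\Lambda:=\Lambda_0\cup\Lambda_1\cup\Lambda_2$. Then $\Lambda_0,\Lambda_1,\Lambda_2$ are pairwise disjoint sets of size $3$, and: (1) if $m\equiv 0\pmod 3$ and $c$ is a cube in $\mathbb{F}_{q^2}$, then $\Gamma_\ell=\Lambda_0$; (2) if $m\equiv 0\pmod 3$ and $c$ is not a cube in $\mathbb{F}_{q^2}$, then $\Gamma_\ell=\Lambda_k$ for the unique $k\in\{1,2\}$ such that $c^{(q^2-1)/3}=\omega^{ -k\ell}$; (3) if $m\not\equiv 0\pmod 3$, then there is a unique $k\in\{0,1,2\}$ for which $\omega^k c$ is a cube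 in $\mathbb{F}_{q^2}$, and: if $k=0$ and $\ell\equiv m\pmod 3$ then $\Gamma_\ell=\Lambda_0$; if $k\neq 0$ and $\ell\equiv m\pmod 3$ then $\Gamma_\ell=\Lambda_{3-k}$; if $k=0$ and $\ell\equiv -m\pmod 3$ then $\Gamma_\ell=\Lambda$; if $k\neq0$ and $\ell\equiv -m\pmod 3$ then $\Gamma_\ell=\emptyset$.
   Context: $\mathrm{Tr}$ denotes the trace map from $\mathbb{F}_q$ to $\mathbb{F}_2$. All fields are viewed inside a fixed algebraic closure of $\mathbb{F}_2$. -}

module Defs where

open import Level using (0ℓ)
open import Algebra.Bundles using (CommutativeRing)
import Data.Nat as N
open N using (ℕ; zero; suc)
open import Data.Fin using (Fin)
open import Data.Product using (Σ; ∃; _×_; _,_)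
open import Data.Sum using (_⊎_)
open import Data.Empty using (⊥)
open import Relation.Nullary using (¬_)
open import Relation.Binary.Definitions using (Decidable)
open import Relation.Binary.PropositionalEquality using (_≡_)

-- A finite field with exactly 2 ^ n elements (hence of characteristic 2).
-- Any two such are isomorphic, so this models F_{2^n}.
-- Equality is the setoid equality _≈_ of the ring.
record GF2^ (n : ℕ) : Set₁ where
  field
    cring    : CommutativeRing 0ℓ 0ℓ
  open CommutativeRing cring public
  field
    _≟_      : Decidable _≈_
    1≉0      : ¬ (1# ≈ 0#)
    _⁻¹      : Carrier → Carrier
    inverseʳ : ∀ x → ¬ (x ≈ 0#) → (x * (x ⁻¹)) ≈ 1#
    enum     : Fin (2 N.^ n) → Carrier
    enum-inj : ∀ i j → enum i ≈ enum j → i ≡ j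
    enum-sur : ∀ x → ∃ λ i → enum i ≈ x

module FieldNotions {n : ℕ} (F : GF2^ n) where
  open GF2^ F

  infixr 8 _^ᶠ_
  _^ᶠ_ : Carrier → ℕ → Carrier
  x ^ᶠ zero  = 1#
  x ^ᶠ suc k = x * (x ^ᶠ k)

  infixl 7 _/ᶠ_
  _/ᶠ_ : Carrier → Carrier → Carrier
  x /ᶠ y = x * (y ⁻¹)

  -- membership in the subfield F_{2^k} = { x | x^(2^k) = x }
  InF2^ : ℕ → Carrier → Set
  InF2^ k x = (x ^ᶠ (2 N.^ k)) ≈ x

  Tr : ℕ → Carrier → Carrier
  Tr zero    x = 0#
  Tr (suc i) x = Tr i x + (x ^ᶠ (2 N.^ i))

  Subset : Set₁
  Subset = Carrier → Set

  _≐_ : Subset → Subset → Set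
  P ≐ Q = ∀ w → (P w → Q w) × (Q w → P w)

  Disjoint : Subset → Subset → Set
  Disjoint P Q = ∀ w → ¬ (P w × Q w)

  HasSize3 : Subset → Set
  HasSize3 P = Σ Carrier λ x → Σ Carrier λ y → Σ Carrier λ z →
    ¬ (x ≈ y) × ¬ (x ≈ z) × ¬ (y ≈ z) ×
    (∀ w → (P w → (w ≈ x ⊎ w ≈ y ⊎ w ≈ z)) × ((w ≈ x ⊎ w ≈ y ⊎ w ≈ z) → P w))

  Empty : Subset
  Empty _ = ⊥

  _∪_ : Subset → Subset → Subset
  (P ∪ Q) w = P w ⊎ Q w

  IsCubeIn : ℕ → Carrier → Set
  IsCubeIn k x = ∃ λ y → InF2^ k y × ((y ^ᶠ 3) ≈ x)

  module Setup (m ℓ : ℕ) (a ω b : Carrier) where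
    q : ℕ
    q = 2 N.^ m

    c : Carrier
    c = (b + ω) /ᶠ (b + (ω ^ᶠ 2))

    Γ : Subset
    Γ x = InF2^ (3 N.* m) x × (((x ^ᶠ (2 N.* (q N.^ ℓ) N.+ 1)) + x + a) ≈ 0#)

    -- v ranges over F_{q^6}, i.e. the whole field
    Λ₀ : Subset
    Λ₀ w = ∃ λ v → InF2^ (6 N.* m) v × ((v ^ᶠ 3) ≈ c) × (w ≈ (v + (v ⁻¹)))

    Λ₁ : Subset
    Λ₁ w = ∃ λ v → InF2^ (6 N.* m) v × ((v ^ᶠ 3) ≈ (ω * c)) ×
      (w ≈ ((a ⁻¹ + v + (v ⁻¹)) /ᶠ (b ^ᶠ 2)))

    Λ₂ : Subset
    Λ₂ w = ∃ λ v → InF2^ (6 N.* m) v × ((v ^ᶠ 3) ≈ ((ω ^ᶠ 2) * c)) ×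
      (w ≈ ((a ⁻¹ + v + (v ⁻¹)) /ᶠ ((b ^ᶠ 2) + 1#)))

    -- Λ_k for k = 0,1,2 (empty for other k, never used)
    Λ_ : ℕ → Subset
    Λ_ 0 = Λ₀
    Λ_ 1 = Λ₁
    Λ_ 2 = Λ₂
    Λ_ (suc (suc (suc _))) = Empty

    Λ : Subset
    Λ = (Λ₀ ∪ Λ₁) ∪ Λ₂

{-# OPTIONS --safe #-}
module Submission where

-- An element x of F_{q³} lies in Γ exactly when x (σ x + 1)² = a, where σ is the q ^ ℓ-power map, and
-- σ³ x = x. So x, σ x, σ² x is a cycle of length 3 (or 1) of the relation x (y + 1)² = a.
-- Eliminating y and z leaves a polynomial of degree 9 in x, which is a product of three cubics; the
-- substitution X = v + v⁻¹ turns these into v³ = c, ω c, ω² c, so all roots lie in Λ. On Λ_k the relation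
-- is realized by v ↦ ω ^ k v. On the other hand Frobenius acts on Λ_k through v ↦ ζ² v with
-- ζ = (ω ^ k c) ^ ((q² - 1) / 3), up to v ↦ v⁻¹. Hence Λ_k lies in Γ or is disjoint from it, according to
-- whether ζ ^ (2 ℓ) = ω ^ k, a congruence modulo 3. Cube roots in F_{q⁶} exist by Hilbert's Theorem 90
-- for x ↦ x⁴.

open import Defs
open import Data.Nat as ℕ using (ℕ; zero; suc; s≤s; z≤n; _∸_; _/_; _%_; _≤_; _<_; _≥_) renaming (_*_ to _*ℕ_; _^_ to _^ℕ_; _+_ to _+ℕ_)
import Data.Nat.Properties as ℕ
open import Data.Nat.Divisibility using (_∣_; m%n≡0⇒n∣m; n∣m⇒m%n≡0)
open import Data.Nat.DivMod using (m≡m%n+[m/n]*n; m%n<n; m*n/n≡m; m<n⇒m%n≡m; %-distribˡ-+)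
open import Data.Nat.Solver using (module +-*-Solver)
open import Data.Bool using (Bool; true; false; _xor_; _∧_)
open import Data.Fin using (Fin; zero; suc; toℕ; fromℕ<; punchIn; inject≤)
open import Data.Fin.Properties using (toℕ<n; toℕ-fromℕ<; all?; any?; punchInᵢ≢i; inject≤-injective; ¬∀⟶∃¬; suc-injective)
open import Data.Fin.Permutation using (Permutation′; _⟨$⟩ʳ_)
open import Data.Maybe using (Maybe; just; nothing)
open import Data.Product as Product using (Σ; ∃; _×_; _,_; proj₁; proj₂)
open import Data.Sum as Sum using (_⊎_; inj₁; inj₂; [_,_]′)
open import Function using (id; _∘_; _⟨_⟩_; mk↔ₛ′)
open import Relation.Nullary using (¬_; Dec; yes; no; contradiction)
open import Relation.Nullary.Decidable using (_×-dec_; _→-dec_; ¬?; toWitness)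
open import Relation.Binary.PropositionalEquality as ≡ using (_≡_; _≢_)
open import Algebra.Bundles using (RawRing)
open import Algebra.Solver.Ring.AlmostCommutativeRing using (fromCommutativeSemiring; _-Raw-AlmostCommutative⟶_)
import Algebra.Solver.Ring

-- In x (y + 1)² = a the value y is determined by x, since squaring is injective. The points on
-- cycles of length 1 or 3 are nine in number: three fixed points, the solutions of x³ + x = a,
-- which form Λ₀, and two genuine 3-cycles, Λ₁ and Λ₂. The number b tells these two apart: with s =
-- 1/a the equation b² + b = s + 1 gives s = b² + b + 1, and squaring shows that B = b² and B + 1
-- are the two roots of T² + T + 1 = s². Lying on a cycle is not enough for Γ: the successor of x
-- must also be its conjugate σ x. On each Λ_k both maps multiply a label e by a fixed cube root of
-- unity, so one point decides for all of Λ_k. If ω is not in F_q, Frobenius exchanges c with 1/c,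
-- and v with a multiple of v⁻¹. The labelling e v + e² v⁻¹ is chosen so that both cases give the
-- same rule for e. Reductions modulo relations such as ω² + ω + 1, v w + 1 or s² + B² + B + 1 are
-- stated as ring identities with explicit cofactors of these relations. The cofactors are the long
-- polynomials below.

module FiniteField {n : ℕ} (F : GF2^ n) where
  open GF2^ F hiding (zero; distrib)
  open FieldNotions F
  import Algebra.Properties.CommutativeSemiring.Exp commutativeSemiring as Exp
  open import Algebra.Properties.CommutativeMonoid.Sum *-commutativeMonoid
    using () renaming (sum to ∏; sum-remove to ∏-remove; ∑-distrib-+ to ∏-distrib; sum-permute to ∏-permute; sum-cong-≋ to ∏-cong; sum-replicate to ∏-replicate)
  open import Algebra.Properties.Ring ring using (-‿distribˡ-*; -‿distribʳ-*)
  open import Algebra.Properties.AbelianGroup +-abelianGroup using (⁻¹-involutive)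
  open import Relation.Binary.Reasoning.Setoid setoid

  -- Powers, cancellation and inverses.

  ^ᶠ≡^ : ∀ x k → x ^ᶠ k ≡ x Exp.^ k
  ^ᶠ≡^ x zero    = ≡.refl
  ^ᶠ≡^ x (suc k) = ≡.cong (x *_) (^ᶠ≡^ x k)

  ^-cong : ∀ k {x y} → x ≈ y → x ^ᶠ k ≈ y ^ᶠ k
  ^-cong k {x} {y} x≈y rewrite ^ᶠ≡^ x k | ^ᶠ≡^ y k = Exp.^-congˡ k x≈y

  ^-+ : ∀ x i j → x ^ᶠ (i +ℕ j) ≈ x ^ᶠ i * x ^ᶠ j
  ^-+ x i j rewrite ^ᶠ≡^ x (i +ℕ j) | ^ᶠ≡^ x i | ^ᶠ≡^ x j = Exp.^-homo-* x i j

  ^-* : ∀ x i j → x ^ᶠ (i *ℕ j) ≈ (x ^ᶠ i) ^ᶠ j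
  ^-* x i j rewrite ^ᶠ≡^ (x ^ᶠ i) j | ^ᶠ≡^ x (i *ℕ j) | ^ᶠ≡^ x i = sym (Exp.^-assocʳ x i j)

  *-^ : ∀ x y k → (x * y) ^ᶠ k ≈ x ^ᶠ k * y ^ᶠ k
  *-^ x y k rewrite ^ᶠ≡^ (x * y) k | ^ᶠ≡^ x k | ^ᶠ≡^ y k = Exp.^-distrib-* x y k

  1^ : ∀ k → 1# ^ᶠ k ≈ 1#
  1^ zero    = refl
  1^ (suc k) = trans (*-identityˡ _) (1^ k)

  x^1 : ∀ x → x ^ᶠ 1 ≈ x
  x^1 = *-identityʳ

  inverseˡ : ∀ x → ¬ x ≈ 0# → x ⁻¹ * x ≈ 1#
  inverseˡ x x≉0 = trans (*-comm _ _) (inverseʳ x x≉0)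

  *-cancelˡ : ∀ {x y z} → ¬ x ≈ 0# → x * y ≈ x * z → y ≈ z
  *-cancelˡ {x} {y} {z} x≉0 eq = begin
    y              ≈⟨ *-identityˡ y ⟨
    1# * y         ≈⟨ *-congʳ (inverseˡ x x≉0) ⟨
    x ⁻¹ * x * y   ≈⟨ *-assoc _ _ _ ⟩
    x ⁻¹ * (x * y) ≈⟨ *-congˡ eq ⟩
    x ⁻¹ * (x * z) ≈⟨ *-assoc _ _ _ ⟨
    x ⁻¹ * x * z   ≈⟨ *-congʳ (inverseˡ x x≉0) ⟩
    1# * z         ≈⟨ *-identityˡ z ⟩
    z              ∎

  *≈0 : ∀ {x y} → x * y ≈ 0# → x ≈ 0# ⊎ y ≈ 0#
  *≈0 {x} {y} eq with x ≟ 0#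
  ... | yes x≈0 = inj₁ x≈0
  ... | no  x≉0 = inj₂ (*-cancelˡ x≉0 (trans eq (sym (zeroʳ x))))

  *≉0 : ∀ {x y} → ¬ x ≈ 0# → ¬ y ≈ 0# → ¬ x * y ≈ 0#
  *≉0 x≉0 y≉0 eq with *≈0 eq
  ... | inj₁ p = x≉0 p
  ... | inj₂ p = y≉0 p

  ^≉0 : ∀ {x} k → ¬ x ≈ 0# → ¬ x ^ᶠ k ≈ 0#
  ^≉0 zero    x≉0 = 1≉0
  ^≉0 (suc k) x≉0 = *≉0 x≉0 (^≉0 k x≉0)

  unit≉0ˡ : ∀ {x y} → x * y ≈ 1# → ¬ x ≈ 0#
  unit≉0ˡ {x} {y} xy≈1 x≈0 = 1≉0 (trans (sym xy≈1) (trans (*-congʳ x≈0) (zeroˡ y)))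

  inverse-unique : ∀ {x y} → x * y ≈ 1# → y ≈ x ⁻¹
  inverse-unique {x} eq = *-cancelˡ x≉0 (trans eq (sym (inverseʳ x x≉0)))
    where x≉0 = unit≉0ˡ eq

  -- Fermat's theorem from a product over all elements.

  private
    index : Carrier → Fin (2 ^ℕ n)
    index x = proj₁ (enum-sur x)

    enum-index : ∀ x → enum (index x) ≈ x
    enum-index x = proj₂ (enum-sur x)

    scale : ∀ {u w} → w * u ≈ 1# → ∀ i → index (w * enum (index (u * enum i))) ≡ i
    scale {u} {w} wu≈1 i = enum-inj _ _ (begin
      enum (index (w * enum (index (u * enum i)))) ≈⟨ enum-index _ ⟩
      w * enum (index (u * enum i))                ≈⟨ *-congˡ (enum-index _) ⟩
      w * (u * enum i)                             ≈⟨ *-assoc _ _ _ ⟨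
      w * u * enum i                               ≈⟨ *-congʳ wu≈1 ⟩
      1# * enum i                                  ≈⟨ *-identityˡ _ ⟩
      enum i                                       ∎)

    scaling : ∀ u → ¬ u ≈ 0# → Permutation′ (2 ^ℕ n)
    scaling u u≉0 = mk↔ₛ′ (λ i → index (u * enum i)) (λ i → index (u ⁻¹ * enum i))
      (scale (inverseʳ u u≉0)) (scale (inverseˡ u u≉0))

    ∏≉0 : ∀ {k} (f : Fin k → Carrier) → (∀ i → ¬ f i ≈ 0#) → ¬ ∏ f ≈ 0#
    ∏≉0 {zero}  f f≉0 = 1≉0
    ∏≉0 {suc k} f f≉0 = *≉0 (f≉0 zero) (∏≉0 (f ∘ suc) (f≉0 ∘ suc))

    -- The factor at `i` is 1 instead of `u`; the additional `u` on the left makes up for it, so the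
    -- exponent is the full `k`.
    ∏-except : ∀ {k} (f : Fin k → Carrier) i u → f i ≈ 1# → (∀ j → j ≢ i → f j ≈ u) →
               u * ∏ f ≈ u ^ᶠ k
    ∏-except {suc k} f i u fi≈1 fj≈u = *-congˡ (begin
      ∏ f                        ≈⟨ ∏-remove {i = i} f ⟩
      f i * ∏ (f ∘ punchIn i)    ≈⟨ *-congʳ fi≈1 ⟩
      1# * ∏ (f ∘ punchIn i)     ≈⟨ *-identityˡ _ ⟩
      ∏ (f ∘ punchIn i)          ≈⟨ ∏-cong (λ j → fj≈u (punchIn i j) (punchInᵢ≢i i j)) ⟩
      ∏ {k} (λ _ → u)            ≈⟨ ∏-replicate k ⟩
      u Exp.^ k                  ≡⟨ ^ᶠ≡^ u k ⟨
      u ^ᶠ k                     ∎)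

    -- Replacing 0 by 1 lets the product run over all of the field.
    nonzero : Carrier → Carrier
    nonzero x with x ≟ 0#
    ... | yes _ = 1#
    ... | no _  = x

    nonzero≉0 : ∀ x → ¬ nonzero x ≈ 0#
    nonzero≉0 x with x ≟ 0#
    ... | yes _  = 1≉0
    ... | no x≉0 = x≉0

    multiplier : Carrier → Carrier → Carrier
    multiplier u x with x ≟ 0#
    ... | yes _ = 1#
    ... | no _  = u

    multiplier-0 : ∀ u {x} → x ≈ 0# → multiplier u x ≈ 1#
    multiplier-0 u {x} x≈0 with x ≟ 0#
    ... | yes _  = refl
    ... | no x≉0 = contradiction x≈0 x≉0

    multiplier-≉0 : ∀ u {x} → ¬ x ≈ 0# → multiplier u x ≈ u
    multiplier-≉0 u {x} x≉0 with x ≟ 0#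
    ... | yes x≈0 = contradiction x≈0 x≉0
    ... | no _    = refl

    nonzero-* : ∀ u {x y} → ¬ u ≈ 0# → y ≈ u * x → nonzero y ≈ multiplier u x * nonzero x
    nonzero-* u {x} {y} u≉0 y≈ux with x ≟ 0# | y ≟ 0#
    ... | yes _   | yes _   = sym (*-identityˡ _)
    ... | yes x≈0 | no y≉0  = contradiction (trans y≈ux (trans (*-congˡ x≈0) (zeroʳ u))) y≉0
    ... | no x≉0  | yes y≈0 = contradiction (trans (sym y≈ux) y≈0) (*≉0 u≉0 x≉0)
    ... | no _    | no _    = y≈ux

  -- Multiplication by a nonzero `u` permutes the field. Comparing the product of the nonzero
  -- elements before and after shows that one factor `u` for each of them gives 1 altogether.
  fermat : ∀ u → u ^ᶠ (2 ^ℕ n) ≈ u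
  fermat u with u ≟ 0#
  ... | yes u≈0 = begin
    u ^ᶠ (2 ^ℕ n) ≈⟨ ^-cong (2 ^ℕ n) u≈0 ⟩
    0# ^ᶠ (2 ^ℕ n) ≈⟨ 0^ (2 ^ℕ n) (ℕ.m^n>0 2 n) ⟩
    0#            ≈⟨ u≈0 ⟨
    u             ∎
    where
    0^ : ∀ k → 1 ≤ k → 0# ^ᶠ k ≈ 0#
    0^ (suc k) _ = zeroˡ _
  ... | no u≉0 = begin
    u ^ᶠ (2 ^ℕ n)   ≈⟨ ∏-except h i₀ u (multiplier-0 u (enum-index 0#)) h≈u ⟨
    u * ∏ h         ≈⟨ *-congˡ ∏h≈1 ⟩
    u * 1#          ≈⟨ *-identityʳ u ⟩
    u               ∎
    where
    h g : Fin (2 ^ℕ n) → Carrier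
    h i = multiplier u (enum i)
    g i = nonzero (enum i)
    i₀ = index 0#
    h≈u : ∀ j → j ≢ i₀ → h j ≈ u
    h≈u j j≢i₀ = multiplier-≉0 u λ ej≈0 → j≢i₀ (enum-inj _ _ (trans ej≈0 (sym (enum-index 0#))))
    ∏h≈1 : ∏ h ≈ 1#
    ∏h≈1 = *-cancelˡ (∏≉0 g (nonzero≉0 ∘ enum)) (begin
      ∏ g * ∏ h                            ≈⟨ *-comm _ _ ⟩
      ∏ h * ∏ g                            ≈⟨ ∏-distrib h g ⟨
      ∏ (λ i → h i * g i)                  ≈⟨ ∏-cong (λ i → nonzero-* u u≉0 (enum-index (u * enum i))) ⟨
      ∏ (λ i → g (scaling u u≉0 ⟨$⟩ʳ i))   ≈⟨ ∏-permute g (scaling u u≉0) ⟨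
      ∏ g                                  ≈⟨ *-identityʳ _ ⟨
      ∏ g * 1#                             ∎)

  -- The order of the field is even, so -1 = (-1) ^ (2 ^ n) = 1.
  char2 : 1 ≤ n → 1# + 1# ≈ 0#
  char2 (s≤s {n = k} z≤n) = begin
    1# + 1#     ≈⟨ +-congˡ 1≈-1 ⟩
    1# + (- 1#) ≈⟨ -‿inverseʳ 1# ⟩
    0#          ∎
    where
    [-1]² : (- 1#) ^ᶠ 2 ≈ 1#
    [-1]² = begin
      (- 1#) ^ᶠ 2     ≈⟨ *-congˡ (*-identityʳ _) ⟩
      (- 1#) * (- 1#) ≈⟨ -‿distribˡ-* _ _ ⟨
      - (1# * (- 1#)) ≈⟨ -‿cong (*-identityˡ _) ⟩
      - (- 1#)        ≈⟨ ⁻¹-involutive 1# ⟩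
      1#              ∎
    1≈-1 : 1# ≈ - 1#
    1≈-1 = begin
      1#                              ≈⟨ 1^ (2 ^ℕ k) ⟨
      1# ^ᶠ (2 ^ℕ k)                  ≈⟨ ^-cong (2 ^ℕ k) [-1]² ⟨
      ((- 1#) ^ᶠ 2) ^ᶠ (2 ^ℕ k)       ≈⟨ ^-* (- 1#) 2 (2 ^ℕ k) ⟨
      (- 1#) ^ᶠ (2 ^ℕ n)              ≈⟨ fermat (- 1#) ⟩
      - 1#                            ∎

-- Identities, Frobenius and polynomial functions in characteristic 2.

module Char2 {n : ℕ} (F : GF2^ n) (n≥1 : 1 ≤ n) where
  open GF2^ F hiding (zero; distrib)
  open FieldNotions F
  open FiniteField F public
  open import Relation.Binary.Reasoning.Setoid setoid

  private
    -- Coefficients in the field with two elements let the solver cancel equal terms in pairs.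
    -- Negation is the identity both here and in the target.
    F₂ : RawRing _ _
    F₂ = record { Carrier = Bool ; _≈_ = _≡_ ; _+_ = _xor_ ; _*_ = _∧_ ; -_ = id ; 0# = false ; 1# = true }

    ⟦_⟧₂ : Bool → Carrier
    ⟦ true ⟧₂ = 1#
    ⟦ false ⟧₂ = 0#

    morphism : F₂ -Raw-AlmostCommutative⟶ fromCommutativeSemiring commutativeSemiring
    morphism = record
      { ⟦_⟧ = ⟦_⟧₂
      ; +-homo = λ { true true → sym (char2 n≥1) ; true false → sym (+-identityʳ _) ; false _ → sym (+-identityˡ _) }
      ; *-homo = λ { true _ → sym (*-identityˡ _) ; false _ → sym (zeroˡ _) }
      ; -‿homo = λ _ → refl
      ; 0-homo = refl
      ; 1-homo = refl
      }

    _≟₂_ : (x y : Bool) → Maybe (⟦ x ⟧₂ ≈ ⟦ y ⟧₂)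
    true  ≟₂ true  = just refl
    false ≟₂ false = just refl
    _     ≟₂ _     = nothing

  open Algebra.Solver.Ring F₂ (fromCommutativeSemiring commutativeSemiring) morphism _≟₂_
    public using (solve; _:=_; _:+_; _:*_; _:^_; con)

  x+x≈0 : ∀ x → x + x ≈ 0#
  x+x≈0 = solve 1 (λ x → x :+ x := con false) refl

  ≈⇒+≈0 : ∀ {x y} → x ≈ y → x + y ≈ 0#
  ≈⇒+≈0 {x} {y} x≈y = trans (+-congʳ x≈y) (x+x≈0 y)

  +≈0⇒≈ : ∀ {x y} → x + y ≈ 0# → x ≈ y
  +≈0⇒≈ {x} {y} eq = begin
    x           ≈⟨ solve 2 (λ x y → x := x :+ y :+ y) refl x y ⟩
    x + y + y   ≈⟨ +-congʳ eq ⟩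
    0# + y      ≈⟨ +-identityˡ y ⟩
    y           ∎

  frob-+ : ∀ k x y → (x + y) ^ᶠ (2 ^ℕ k) ≈ x ^ᶠ (2 ^ℕ k) + y ^ᶠ (2 ^ℕ k)
  frob-+ zero    x y = solve 2 (λ x y → (x :+ y) :^ 1 := x :^ 1 :+ y :^ 1) refl x y
  frob-+ (suc k) x y = begin
    (x + y) ^ᶠ (2 *ℕ 2 ^ℕ k)                      ≈⟨ ^-* (x + y) 2 (2 ^ℕ k) ⟩
    ((x + y) ^ᶠ 2) ^ᶠ (2 ^ℕ k)                    ≈⟨ ^-cong (2 ^ℕ k) (solve 2 (λ x y → (x :+ y) :^ 2 := x :^ 2 :+ y :^ 2) refl x y) ⟩
    (x ^ᶠ 2 + y ^ᶠ 2) ^ᶠ (2 ^ℕ k)                 ≈⟨ frob-+ k (x ^ᶠ 2) (y ^ᶠ 2) ⟩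
    (x ^ᶠ 2) ^ᶠ (2 ^ℕ k) + (y ^ᶠ 2) ^ᶠ (2 ^ℕ k)   ≈⟨ +-cong (^-* x 2 (2 ^ℕ k)) (^-* y 2 (2 ^ℕ k)) ⟨
    x ^ᶠ (2 *ℕ 2 ^ℕ k) + y ^ᶠ (2 *ℕ 2 ^ℕ k)       ∎

  frob-0 : ∀ k → 0# ^ᶠ (2 ^ℕ k) ≈ 0#
  frob-0 k with 2 ^ℕ k | ℕ.m^n>0 2 k
  ... | suc j | _ = zeroˡ _

  x²≈0 : ∀ {x} → x ^ᶠ 2 ≈ 0# → x ≈ 0#
  x²≈0 {x} eq with x ≟ 0#
  ... | yes x≈0 = x≈0
  ... | no x≉0  = contradiction eq (^≉0 2 x≉0)

  square-injective : ∀ {x y} → x ^ᶠ 2 ≈ y ^ᶠ 2 → x ≈ y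
  square-injective {x} {y} eq = +≈0⇒≈ (x²≈0 (begin
    (x + y) ^ᶠ 2    ≈⟨ solve 2 (λ x y → (x :+ y) :^ 2 := x :^ 2 :+ y :^ 2) refl x y ⟩
    x ^ᶠ 2 + y ^ᶠ 2 ≈⟨ ≈⇒+≈0 eq ⟩
    0#              ∎))

  -- Polynomial functions of degree below k, and monic ones of degree k.
  Low Monic : ℕ → (Carrier → Carrier) → Set
  Low zero    f = ∀ x → f x ≈ 0#
  Low (suc k) f = Σ (Carrier → Carrier) λ g → Σ Carrier λ c → Low k g × (∀ x → f x ≈ x * g x + c)
  Monic zero    f = ∀ x → f x ≈ 1#
  Monic (suc k) f = Σ (Carrier → Carrier) λ g → Σ Carrier λ c → Monic k g × (∀ x → f x ≈ x * g x + c)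

  low-+ : ∀ j k {f g} → j ≤ k → Low j f → Low k g → Low k (λ x → f x + g x)
  low-+ zero    zero    _         f≈0 g≈0 x = trans (+-cong (f≈0 x) (g≈0 x)) (+-identityʳ 0#)
  low-+ zero    (suc k) _         f≈0 (g′ , c , lg′ , eq) =
    g′ , c , lg′ , λ x → trans (+-congʳ (f≈0 x)) (trans (+-identityˡ _) (eq x))
  low-+ (suc j) (suc k) {f} {g} (s≤s j≤k) (f′ , c , lf′ , eqf) (g′ , d , lg′ , eqg) =
    _ , c + d , low-+ j k j≤k lf′ lg′ , λ x → begin
      f x + g x                       ≈⟨ +-cong (eqf x) (eqg x) ⟩
      x * f′ x + c + (x * g′ x + d)   ≈⟨ solve 5 (λ x f c g d → x :* f :+ c :+ (x :* g :+ d) := x :* (f :+ g) :+ (c :+ d)) refl x (f′ x) c (g′ x) d ⟩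
      x * (f′ x + g′ x) + (c + d)     ∎

  low-weaken : ∀ {j k f} → j ≤ k → Low j f → Low k f
  low-weaken {zero}  {zero}  _ f≈0 = f≈0
  low-weaken {zero}  {suc k} _ f≈0 = (λ _ → 0#) , 0# , low-weaken {zero} {k} z≤n (λ _ → refl) , λ x →
    trans (f≈0 x) (solve 1 (λ x → con false := x :* con false :+ con false) refl x)
  low-weaken {suc j} {suc k} (s≤s j≤k) (g , c , lg , eq) = g , c , low-weaken j≤k lg , eq

  low-monomial : ∀ k c → Low (suc k) (λ x → c * x ^ᶠ k)
  low-monomial zero    c = (λ _ → 0#) , c , (λ _ → refl) , λ x →
    solve 2 (λ x c → c :* con true := x :* con false :+ c) refl x c
  low-monomial (suc k) c = _ , 0# , low-monomial k c , λ x →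
    solve 3 (λ x c y → c :* (x :* y) := x :* (c :* y) :+ con false) refl x c (x ^ᶠ k)

  low-scale : ∀ k {f} u → Low k f → Low k (λ x → u * f x)
  low-scale zero    u f≈0 x = trans (*-congˡ (f≈0 x)) (zeroʳ u)
  low-scale (suc k) u (g , c , lg , eq) = _ , u * c , low-scale k u lg , λ x →
    trans (*-congˡ (eq x)) (solve 4 (λ u x g c → u :* (x :* g :+ c) := x :* (u :* g) :+ u :* c) refl u x (g x) c)

  monic-power : ∀ k → Monic k (_^ᶠ k)
  monic-power zero    x = refl
  monic-power (suc k) = _ , 0# , monic-power k , λ x → sym (+-identityʳ _)

  monic-+-low : ∀ j k {f g} → j ≤ k → Monic k f → Low j g → Monic k (λ x → f x + g x)
  monic-+-low zero zero _ f≈1 g≈0 x = trans (+-cong (f≈1 x) (g≈0 x)) (+-identityʳ 1#)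
  monic-+-low zero (suc k) _ (f′ , c , mf′ , eq) g≈0 =
    f′ , c , mf′ , λ x → trans (+-congˡ (g≈0 x)) (trans (+-identityʳ _) (eq x))
  monic-+-low (suc j) (suc k) {f} {g} (s≤s j≤k) (f′ , c , mf′ , eqf) (g′ , d , lg′ , eqg) =
    _ , c + d , monic-+-low j k j≤k mf′ lg′ , λ x → begin
      f x + g x                       ≈⟨ +-cong (eqf x) (eqg x) ⟩
      x * f′ x + c + (x * g′ x + d)   ≈⟨ solve 5 (λ x f c g d → x :* f :+ c :+ (x :* g :+ d) := x :* (f :+ g) :+ (c :+ d)) refl x (f′ x) c (g′ x) d ⟩
      x * (f′ x + g′ x) + (c + d)     ∎

  -- The factor theorem for f x - f r rather than for a root `r`: the Horner quotient need not
  -- vanish at `r`, so only this form passes through the induction.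
  monic-quotient : ∀ k {f} → Monic (suc k) f → ∀ r →
    Σ (Carrier → Carrier) λ g → Monic k g × (∀ x → f x + f r ≈ (x + r) * g x)
  monic-quotient zero {f} (g , c , g≈1 , eq) r = (λ _ → 1#) , (λ _ → refl) , λ x → begin
    f x + f r                        ≈⟨ +-cong (eq x) (eq r) ⟩
    x * g x + c + (r * g r + c)      ≈⟨ +-cong (+-congʳ (*-congˡ (g≈1 x))) (+-congʳ (*-congˡ (g≈1 r))) ⟩
    x * 1# + c + (r * 1# + c)        ≈⟨ solve 3 (λ x r c → x :* con true :+ c :+ (r :* con true :+ c) := (x :+ r) :* con true) refl x r c ⟩
    (x + r) * 1#                     ∎
  monic-quotient (suc k) {f} (g , c , mg , eq) r with monic-quotient k mg r
  ... | h , mh , eqh = (λ x → x * h x + g r) , (h , g r , mh , λ _ → refl) , λ x → begin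
    f x + f r                        ≈⟨ +-cong (eq x) (eq r) ⟩
    x * g x + c + (r * g r + c)      ≈⟨ solve 5 (λ x r c u v → x :* u :+ c :+ (r :* v :+ c) := x :* (u :+ v) :+ (x :+ r) :* v) refl x r c (g x) (g r) ⟩
    x * (g x + g r) + (x + r) * g r  ≈⟨ +-congʳ (*-congˡ (eqh x)) ⟩
    x * ((x + r) * h x) + (x + r) * g r ≈⟨ solve 4 (λ x r h v → x :* ((x :+ r) :* h) :+ (x :+ r) :* v := (x :+ r) :* (x :* h :+ v)) refl x r (h x) (g r) ⟩
    (x + r) * (x * h x + g r)        ∎

  monic-root-bound : ∀ k {f} → Monic k f → (r : Fin (suc k) → Carrier) →
    (∀ i j → r i ≈ r j → i ≡ j) → ¬ (∀ i → f (r i) ≈ 0#)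
  monic-root-bound zero    f≈1 r r-inj fr≈0 = 1≉0 (trans (sym (f≈1 (r zero))) (fr≈0 zero))
  monic-root-bound (suc k) {f} mf r r-inj fr≈0 with monic-quotient k mf (r zero)
  ... | g , mg , eq = monic-root-bound k mg (r ∘ suc) (λ i j e → suc-injective (r-inj _ _ e)) gr≈0
    where
    gr≈0 : ∀ i → g (r (suc i)) ≈ 0#
    gr≈0 i with *≈0 (trans (sym (eq (r (suc i)))) (trans (+-cong (fr≈0 (suc i)) (fr≈0 zero)) (+-identityʳ 0#)))
    ... | inj₂ p = p
    ... | inj₁ p with r-inj _ _ (+≈0⇒≈ p)
    ...   | ()

  monic-nonvanishing : ∀ k {f} → Monic k f → k ℕ.< 2 ^ℕ n → (∀ {x y} → x ≈ y → f x ≈ f y) →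
    ∃ λ x → ¬ f x ≈ 0#
  monic-nonvanishing k {f} mf k<N f-cong with ¬∀⟶∃¬ (2 ^ℕ n) (λ i → f (enum i) ≈ 0#) (λ i → f (enum i) ≟ 0#)
      (λ all0 → monic-root-bound k mf (λ i → enum (inject≤ i k<N)) (λ i j e → inject≤-injective k<N k<N i j (enum-inj _ _ e)) (λ i → all0 _))
  ... | i , fi≉0 = enum i , fi≉0

-- (4 ^ k - 1) / 3
repunit : ℕ → ℕ
repunit zero    = 0
repunit (suc k) = suc (repunit k *ℕ 4)

repunit-+ : ∀ i j → repunit (i +ℕ j) ≡ repunit i +ℕ 4 ^ℕ i *ℕ repunit j
repunit-+ zero    j = ≡.sym (ℕ.+-identityʳ _)
repunit-+ (suc i) j rewrite repunit-+ i j =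
  let open +-*-Solver in
  solve 3 (λ r p s → con 1 :+ (r :+ p :* s) :* con 4 := con 1 :+ r :* con 4 :+ con 4 :* p :* s) ≡.refl (repunit i) (4 ^ℕ i) (repunit j)

repunit-*3 : ∀ k → suc (repunit k *ℕ 3) ≡ 4 ^ℕ k
repunit-*3 zero    = ≡.refl
repunit-*3 (suc k) = ≡.trans
  (let open +-*-Solver in solve 1 (λ r → con 1 :+ (con 1 :+ r :* con 4) :* con 3 := con 4 :* (con 1 :+ r :* con 3)) ≡.refl (repunit k))
  (≡.cong (4 *ℕ_) (repunit-*3 k))

[2^k]²≡4^k : ∀ k → (2 ^ℕ k) ^ℕ 2 ≡ 4 ^ℕ k
[2^k]²≡4^k k = ≡.trans (ℕ.^-*-assoc 2 k 2) (≡.trans (≡.cong (2 ^ℕ_) (ℕ.*-comm k 2)) (≡.sym (ℕ.^-*-assoc 2 2 k)))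

module Hilbert90 {n : ℕ} (F : GF2^ n) (n≥1 : 1 ≤ n) where
  open GF2^ F hiding (zero; distrib)
  open FieldNotions F
  open Char2 F n≥1
  open import Relation.Binary.Reasoning.Setoid setoid

  -- The Lagrange resolvent for x ↦ x⁴: the sum over i < k of d^(1 + 4 + ... + 4^(i-1)) θ^(4^i).
  resolvent : Carrier → ℕ → Carrier → Carrier
  resolvent d zero    θ = 0#
  resolvent d (suc k) θ = resolvent d k θ + d ^ᶠ repunit k * θ ^ᶠ (4 ^ℕ k)

  resolvent-cong : ∀ d k {θ η} → θ ≈ η → resolvent d k θ ≈ resolvent d k η
  resolvent-cong d zero    eq = refl
  resolvent-cong d (suc k) eq = +-cong (resolvent-cong d k eq) (*-congˡ (^-cong (4 ^ℕ k) eq))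

  resolvent-low : ∀ d k → Low (4 ^ℕ k) (resolvent d k)
  resolvent-low d zero    = low-weaken {0} {1} z≤n (λ _ → refl)
  resolvent-low d (suc k) = low-weaken (ℕ.m<m*n (4 ^ℕ k) 4 (s≤s (s≤s z≤n)) ⟨ ℕ.≤-trans ⟩ ℕ.≤-reflexive (ℕ.*-comm (4 ^ℕ k) 4))
    (low-+ (4 ^ℕ k) _ (ℕ.n≤1+n _) (resolvent-low d k) (low-monomial (4 ^ℕ k) _))
    where instance _ = ℕ.m^n≢0 4 k

  -- In θ this is a polynomial of degree 4^k with leading coefficient d^(repunit k). Divided by it,
  -- it is monic and has at most 4^k roots, fewer than there are elements.
  resolvent-nonvanishing : ∀ {d} k → ¬ d ≈ 0# → 4 ^ℕ k ℕ.< 2 ^ℕ n → ∃ λ θ → ¬ resolvent d (suc k) θ ≈ 0#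
  resolvent-nonvanishing {d} k d≉0 lt
    with monic-nonvanishing (4 ^ℕ k)
           (monic-+-low (4 ^ℕ k) (4 ^ℕ k) ℕ.≤-refl (monic-power (4 ^ℕ k)) (low-scale (4 ^ℕ k) (D ⁻¹) (resolvent-low d k)))
           lt (λ eq → +-cong (^-cong (4 ^ℕ k) eq) (*-congˡ (resolvent-cong d k eq)))
    where D = d ^ᶠ repunit k
  ... | θ , ≉0 = θ , λ res≈0 → ≉0 (begin
    t + D ⁻¹ * r               ≈⟨ +-congʳ (*-identityˡ t) ⟨
    1# * t + D ⁻¹ * r          ≈⟨ +-congʳ (*-congʳ (inverseˡ D (^≉0 (repunit k) d≉0))) ⟨
    D ⁻¹ * D * t + D ⁻¹ * r    ≈⟨ solve 4 (λ i D t r → i :* D :* t :+ i :* r := i :* (r :+ D :* t)) refl (D ⁻¹) D t r ⟩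
    D ⁻¹ * (r + D * t)         ≈⟨ *-congˡ res≈0 ⟩
    D ⁻¹ * 0#                  ≈⟨ zeroʳ _ ⟩
    0#                         ∎)
    where
    D = d ^ᶠ repunit k
    t = θ ^ᶠ (4 ^ℕ k)
    r = resolvent d k θ

  -- The fourth power shifts each term to the next index, and the factor `d` corrects the exponent,
  -- because `repunit (suc i)` is 1 + 4 `repunit i`. Only the term `θ` of index 0 has to be added.
  resolvent-step : ∀ d k θ → resolvent d (suc k) θ ≈ θ + d * resolvent d k θ ^ᶠ 4
  resolvent-step d zero θ = solve 2 (λ d θ → con false :+ con true :* θ :^ 1 := θ :+ d :* con false :^ 4) refl d θ
  resolvent-step d (suc k) θ = begin
    R + d * d ^ᶠ (S *ℕ 4) * θ ^ᶠ (4 *ℕ 4 ^ℕ k)        ≈⟨ +-cong (resolvent-step d k θ) (*-cong (*-congˡ (^-* d S 4)) (trans (reflexive (≡.cong (θ ^ᶠ_) (ℕ.*-comm 4 (4 ^ℕ k)))) (^-* θ (4 ^ℕ k) 4))) ⟩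
    θ + d * r ^ᶠ 4 + d * (d ^ᶠ S) ^ᶠ 4 * (θ ^ᶠ (4 ^ℕ k)) ^ᶠ 4 ≈⟨ solve 5 (λ θ d r D t → θ :+ d :* r :^ 4 :+ d :* D :^ 4 :* t :^ 4 := θ :+ d :* (r :+ D :* t) :^ 4) refl θ d r (d ^ᶠ S) (θ ^ᶠ (4 ^ℕ k)) ⟩
    θ + d * R ^ᶠ 4 ∎
    where
    S = repunit k
    r = resolvent d k θ
    R = resolvent d (suc k) θ

  inverse-cube : ∀ {d y} → ¬ y ≈ 0# → y ≈ d * y ^ᶠ 4 → (y ⁻¹) ^ᶠ 3 ≈ d
  inverse-cube {d} {y} y≉0 y≈dy⁴ = *-cancelˡ (^≉0 3 y≉0) (begin
    y ^ᶠ 3 * (y ⁻¹) ^ᶠ 3   ≈⟨ *-^ y (y ⁻¹) 3 ⟨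
    (y * y ⁻¹) ^ᶠ 3        ≈⟨ ^-cong 3 (inverseʳ y y≉0) ⟩
    1# ^ᶠ 3                ≈⟨ 1^ 3 ⟩
    1#                     ≈⟨ *-cancelˡ y≉0 y*1≈y*y³d ⟩
    y ^ᶠ 3 * d             ∎)
    where
    y*1≈y*y³d : y * 1# ≈ y * (y ^ᶠ 3 * d)
    y*1≈y*y³d = begin
      y * 1#                 ≈⟨ *-identityʳ y ⟩
      y                      ≈⟨ y≈dy⁴ ⟩
      d * y ^ᶠ 4             ≈⟨ solve 2 (λ d y → d :* y :^ 4 := y :* (y :^ 3 :* d)) refl d y ⟩
      y * (y ^ᶠ 3 * d)       ∎

  -- Hilbert 90 for the Frobenius x ↦ x⁴ over F₄: norm one elements have the form y⁻³ = y / y⁴.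
  norm-one⇒cube : ∀ k {d} → n ≡ 2 *ℕ suc k → ¬ d ≈ 0# → d ^ᶠ repunit (suc k) ≈ 1# → ∃ λ v → v ^ᶠ 3 ≈ d
  norm-one⇒cube k {d} n≡2k d≉0 norm≈1 = y ⁻¹ , inverse-cube (proj₂ nonvanishing) y≈dy⁴
    where
    4^k<2^n : 4 ^ℕ k ℕ.< 2 ^ℕ n
    4^k<2^n rewrite n≡2k | ≡.sym (ℕ.^-*-assoc 2 2 (suc k)) = ℕ.^-monoʳ-< 4 (s≤s (s≤s z≤n)) (ℕ.n<1+n k)
    nonvanishing = resolvent-nonvanishing k d≉0 4^k<2^n
    θ = proj₁ nonvanishing
    y = resolvent d (suc k) θ
    θ-fixed : θ ^ᶠ (4 ^ℕ suc k) ≈ θ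
    θ-fixed = trans (reflexive (≡.cong (θ ^ᶠ_) (≡.trans (ℕ.^-*-assoc 2 2 (suc k)) (≡.cong (2 ^ℕ_) (≡.sym n≡2k))))) (fermat θ)
    y≈dy⁴ : y ≈ d * y ^ᶠ 4
    y≈dy⁴ = begin
      y                                                          ≈⟨ solve 2 (λ y θ → y := y :+ θ :+ θ) refl y θ ⟩
      -- By norm one and Fermat the next term of the resolvent is `θ` again: the sum closes up
      -- cyclically.
      y + θ + θ                                                  ≈⟨ +-congʳ (+-congˡ (trans (*-cong norm≈1 θ-fixed) (*-identityˡ θ))) ⟨
      resolvent d (suc (suc k)) θ + θ                            ≈⟨ +-congʳ (resolvent-step d (suc k) θ) ⟩
      θ + d * y ^ᶠ 4 + θ                                         ≈⟨ solve 2 (λ θ z → θ :+ z :+ θ := z) refl θ (d * y ^ᶠ 4) ⟩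
      d * y ^ᶠ 4                                                 ∎

  unit-pow-repunit : ∀ k {d} → ¬ d ≈ 0# → d ^ᶠ (4 ^ℕ k) ≈ d → (d ^ᶠ repunit k) ^ᶠ 3 ≈ 1#
  unit-pow-repunit k {d} d≉0 fixed = *-cancelˡ d≉0 (begin
    d * (d ^ᶠ repunit k) ^ᶠ 3        ≈⟨ *-congˡ (^-* d (repunit k) 3) ⟨
    d ^ᶠ suc (repunit k *ℕ 3)        ≡⟨ ≡.cong (d ^ᶠ_) (repunit-*3 k) ⟩
    d ^ᶠ (4 ^ℕ k)                    ≈⟨ fixed ⟩
    d                                ≈⟨ *-identityʳ d ⟨
    d * 1#                           ∎)

  -- The norm of `d` down to F₄ has exponent 1 + 4 + ... + 4^(3m-1). As x ↦ x^(4^m) fixes `d`, this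
  -- splits into three equal blocks, and the norm is e³ with e = d^((4^m - 1)/3), that is d^(4^m -
  -- 1) = 1.
  subfield-cube : ∀ m {d} → 1 ≤ m → n ≡ 6 *ℕ m → ¬ d ≈ 0# → d ^ᶠ (4 ^ℕ m) ≈ d → ∃ λ v → v ^ᶠ 3 ≈ d
  subfield-cube m@(suc k) {d} (s≤s z≤n) n≡6m d≉0 fixed =
    norm-one⇒cube _ (≡.trans n≡6m (ℕ.*-assoc 2 3 m)) d≉0 (begin
      d ^ᶠ repunit (m +ℕ (m +ℕ (m +ℕ 0)))             ≈⟨ split (m +ℕ (m +ℕ 0)) ⟩
      e * d ^ᶠ repunit (m +ℕ (m +ℕ 0))                ≈⟨ *-congˡ (split (m +ℕ 0)) ⟩
      e * (e * d ^ᶠ repunit (m +ℕ 0))                 ≈⟨ *-congˡ (*-congˡ (split 0)) ⟩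
      e ^ᶠ 3                                          ≈⟨ unit-pow-repunit m d≉0 fixed ⟩
      1#                                              ∎)
    where
    e = d ^ᶠ repunit m
    split : ∀ j → d ^ᶠ repunit (m +ℕ j) ≈ e * d ^ᶠ repunit j
    split j = begin
      d ^ᶠ repunit (m +ℕ j)                          ≡⟨ ≡.cong (d ^ᶠ_) (repunit-+ m j) ⟩
      d ^ᶠ (repunit m +ℕ 4 ^ℕ m *ℕ repunit j)        ≈⟨ ^-+ d (repunit m) _ ⟩
      e * d ^ᶠ (4 ^ℕ m *ℕ repunit j)                 ≈⟨ *-congˡ (trans (^-* d (4 ^ℕ m) (repunit j)) (^-cong (repunit j) fixed)) ⟩
      e * d ^ᶠ repunit j                             ∎

GeneratesF₄ : ∀ {n} (F : GF2^ n) → GF2^.Carrier F → Set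
GeneratesF₄ F ω = ω ^ᶠ 2 ≈ ω + 1#
  where
  open GF2^ F
  open FieldNotions F

-- Cube roots of unity and the cubic T³ + T = v³ + v⁻³.

module CubeRootsOfUnity {n : ℕ} (F : GF2^ n) (n≥1 : 1 ≤ n)
  (ω : GF2^.Carrier F) (ω²≈ω+1 : GeneratesF₄ F ω) where
  open GF2^ F hiding (zero; distrib)
  open FieldNotions F
  open Hilbert90 F n≥1 public
  open Char2 F n≥1 public
  open import Relation.Binary.Reasoning.Setoid setoid

  *≈0ʳ : ∀ p {u} → u ≈ 0# → p * u ≈ 0#
  *≈0ʳ p u≈0 = trans (*-congˡ u≈0) (zeroʳ p)

  infixl 6 _+≈0_
  _+≈0_ : ∀ {u v} → u ≈ 0# → v ≈ 0# → u + v ≈ 0#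
  u≈0 +≈0 v≈0 = trans (+-cong u≈0 v≈0) (+-identityʳ 0#)

  ω²+ω+1≈0 : ω ^ᶠ 2 + (ω + 1#) ≈ 0#
  ω²+ω+1≈0 = ≈⇒+≈0 ω²≈ω+1

  ω³≈1 : ω ^ᶠ 3 ≈ 1#
  ω³≈1 = +≈0⇒≈ (trans
    (solve 1 (λ ω → ω :^ 3 :+ con true := (ω :+ con true) :* (ω :^ 2 :+ (ω :+ con true))) refl ω)
    (*≈0ʳ _ ω²+ω+1≈0))

  ω≉1 : ¬ ω ≈ 1#
  ω≉1 ω≈1 = 1≉0 (begin
    1#              ≈⟨ solve 0 (con true := con true :^ 2 :+ (con true :+ con true)) refl ⟩
    1# ^ᶠ 2 + (1# + 1#) ≈⟨ +-cong (^-cong 2 ω≈1) (+-congʳ ω≈1) ⟨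
    ω ^ᶠ 2 + (ω + 1#)   ≈⟨ ω²+ω+1≈0 ⟩
    0#                  ∎)

  Unity : Carrier → Set
  Unity e = e ^ᶠ 3 ≈ 1#

  unity-1 : Unity 1#
  unity-1 = 1^ 3

  unity-* : ∀ {e f} → Unity e → Unity f → Unity (e * f)
  unity-* {e} {f} ue uf = trans (*-^ e f 3) (trans (*-cong ue uf) (*-identityʳ 1#))

  unity-^ : ∀ k {e} → Unity e → Unity (e ^ᶠ k)
  unity-^ zero    ue = unity-1
  unity-^ (suc k) ue = unity-* ue (unity-^ k ue)

  unity-% : ∀ k {e} → Unity e → e ^ᶠ k ≈ e ^ᶠ (k % 3)
  unity-% k {e} ue = begin
    e ^ᶠ k                              ≡⟨ ≡.cong (e ^ᶠ_) (≡.trans (m≡m%n+[m/n]*n k 3) (≡.cong (k % 3 +ℕ_) (ℕ.*-comm (k / 3) 3))) ⟩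
    e ^ᶠ (k % 3 +ℕ 3 *ℕ (k / 3))        ≈⟨ ^-+ e (k % 3) _ ⟩
    e ^ᶠ (k % 3) * e ^ᶠ (3 *ℕ (k / 3))  ≈⟨ *-congˡ (trans (^-* e 3 (k / 3)) (trans (^-cong (k / 3) ue) (1^ (k / 3)))) ⟩
    e ^ᶠ (k % 3) * 1#                   ≈⟨ *-identityʳ _ ⟩
    e ^ᶠ (k % 3)                        ∎

  unity-4 : ∀ {e} → Unity e → e ^ᶠ 4 ≈ e
  unity-4 ue = trans (*-congˡ ue) (*-identityʳ _)

  unity-cases : ∀ {e} → Unity e → e ≈ 1# ⊎ e ≈ ω ⊎ e ≈ ω ^ᶠ 2
  unity-cases {e} ue = Sum.map +≈0⇒≈ (λ p → Sum.map +≈0⇒≈ +≈0⇒≈ (*≈0 p)) (*≈0 {e + 1#} {(e + ω) * (e + ω ^ᶠ 2)} (trans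
    (solve 2 (λ e ω → (e :+ con true) :* ((e :+ ω) :* (e :+ ω :^ 2)) :=
      (e :^ 3 :+ con true) :+ (e :^ 2 :+ e :* ω :+ ω :+ con true) :* (ω :^ 2 :+ (ω :+ con true))) refl e ω)
    (≈⇒+≈0 ue +≈0 *≈0ʳ _ ω²+ω+1≈0)))

  ω²≉1 : ¬ ω ^ᶠ 2 ≈ 1#
  ω²≉1 eq = ω≉1 (square-injective (trans eq (sym (1^ 2))))

  ω²≉ω : ¬ ω ^ᶠ 2 ≈ ω
  ω²≉ω eq = 1≉0 (trans (solve 1 (λ ω → con true := ω :^ 2 :+ ω :+ (ω :^ 2 :+ (ω :+ con true))) refl ω)
    (≈⇒+≈0 eq +≈0 ω²+ω+1≈0))

  ω^-injective : ∀ i j → ω ^ᶠ i ≈ ω ^ᶠ j → i % 3 ≡ j % 3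
  ω^-injective i j eq = ≡.trans (≡.sym (toℕ-fromℕ< (m%n<n i 3))) (≡.trans (≡.cong toℕ (distinct _ _ (begin
    ω ^ᶠ toℕ (fromℕ< (m%n<n i 3))  ≡⟨ ≡.cong (ω ^ᶠ_) (toℕ-fromℕ< (m%n<n i 3)) ⟩
    ω ^ᶠ (i % 3)                   ≈⟨ unity-% i ω³≈1 ⟨
    ω ^ᶠ i                         ≈⟨ eq ⟩
    ω ^ᶠ j                         ≈⟨ unity-% j ω³≈1 ⟩
    ω ^ᶠ (j % 3)                   ≡⟨ ≡.cong (ω ^ᶠ_) (toℕ-fromℕ< (m%n<n j 3)) ⟨
    ω ^ᶠ toℕ (fromℕ< (m%n<n j 3))  ∎))) (toℕ-fromℕ< (m%n<n j 3)))
    where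
    distinct : ∀ (i j : Fin 3) → ω ^ᶠ toℕ i ≈ ω ^ᶠ toℕ j → i ≡ j
    distinct zero             zero             eq = ≡.refl
    distinct zero             (suc zero)       eq = contradiction (trans (sym (x^1 ω)) (sym eq)) ω≉1
    distinct zero             (suc (suc zero)) eq = contradiction (sym eq) ω²≉1
    distinct (suc zero)       zero             eq = contradiction (trans (sym (x^1 ω)) eq) ω≉1
    distinct (suc zero)       (suc zero)       eq = ≡.refl
    distinct (suc zero)       (suc (suc zero)) eq = contradiction (trans (sym eq) (x^1 ω)) ω²≉ω
    distinct (suc (suc zero)) zero             eq = contradiction eq ω²≉1
    distinct (suc (suc zero)) (suc zero)       eq = contradiction (trans eq (x^1 ω)) ω²≉ω
    distinct (suc (suc zero)) (suc (suc zero)) eq = ≡.refl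

  ω^-cong : ∀ i j → i % 3 ≡ j % 3 → ω ^ᶠ i ≈ ω ^ᶠ j
  ω^-cong i j eq = trans (unity-% i ω³≈1) (trans (reflexive (≡.cong (ω ^ᶠ_) eq)) (sym (unity-% j ω³≈1)))

  -- Each power of 4 is 1 modulo 3, so the `k` summands of `repunit k` add up to `k`.
  ω^repunit : ∀ k → ω ^ᶠ repunit k ≈ ω ^ᶠ k
  ω^repunit zero    = refl
  ω^repunit (suc k) = *-congˡ (trans (^-* ω (repunit k) 4) (trans (unity-4 (unity-^ (repunit k) ω³≈1)) (ω^repunit k)))

  -- The three roots of unity add up to 0, so two distinct ones sum to the third. This serves
  -- injectivity of `tr`: squaring being additive, `tr e v w + tr f v w` is `tr (e + f) v w`, again
  -- of the same kind.
  unity-+ : ∀ {e f} → Unity e → Unity f → ¬ e ≈ f → Unity (e + f)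
  unity-+ {e} {f} ue uf e≉f = +≈0⇒≈ (trans
    (solve 2 (λ e f → (e :+ f) :^ 3 :+ con true := (e :^ 3 :+ con true) :+ f :* (e :^ 2 :+ (e :* f :+ f :^ 2))) refl e f)
    (≈⇒+≈0 ue +≈0 *≈0ʳ f e²+ef+f²≈0))
    where
    e²+ef+f²≈0 : e ^ᶠ 2 + (e * f + f ^ᶠ 2) ≈ 0#
    e²+ef+f²≈0 = [ (λ p → contradiction (+≈0⇒≈ p) e≉f) , (λ p → p) ]′ (*≈0 (trans
      (solve 2 (λ e f → (e :+ f) :* (e :^ 2 :+ (e :* f :+ f :^ 2)) := e :^ 3 :+ f :^ 3) refl e f)
      (≈⇒+≈0 (trans ue (sym uf)))))

  -- The roots of T³ + T = v³ + v⁻³ are tr e v w with w = v⁻¹ and e³ = 1.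
  tr : Carrier → Carrier → Carrier → Carrier
  tr e v w = e * v + e ^ᶠ 2 * w

  tr-cong : ∀ {e f v v′ w w′} → e ≈ f → v ≈ v′ → w ≈ w′ → tr e v w ≈ tr f v′ w′
  tr-cong e≈f v≈v′ w≈w′ = +-cong (*-cong e≈f v≈v′) (*-cong (^-cong 2 e≈f) w≈w′)

  tr-1 : ∀ v w → tr 1# v w ≈ v + w
  tr-1 = solve 2 (λ v w → con true :* v :+ con true :^ 2 :* w := v :+ w) refl

  -- In characteristic 2, T³ + T is the Dickson polynomial T³ - 3T, which takes v + v⁻¹ to v³ + v⁻³.
  -- Replacing v by e v does not change the cube.
  tr-cubic : ∀ {e v w} → Unity e → v * w ≈ 1# → tr e v w ^ᶠ 3 + tr e v w ≈ v ^ᶠ 3 + w ^ᶠ 3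
  tr-cubic {e} {v} {w} ue vw≈1 = +≈0⇒≈ (trans
    (solve 3 (λ e v w → let t = e :* v :+ e :^ 2 :* w in
      t :^ 3 :+ t :+ (v :^ 3 :+ w :^ 3) :=
      (e :^ 3 :* w :^ 3 :+ e :^ 2 :* v :* w :^ 2 :+ e :* v :^ 2 :* w :+ v :^ 3 :+ w :^ 3) :* (e :^ 3 :+ con true)
      :+ (e :^ 2 :* w :+ e :* v) :* (v :* w :+ con true)) refl e v w)
    (*≈0ʳ _ (≈⇒+≈0 ue) +≈0 *≈0ʳ _ (≈⇒+≈0 vw≈1)))

  tr-cover : ∀ {X v w} → v * w ≈ 1# → X ^ᶠ 3 + X ≈ v ^ᶠ 3 + w ^ᶠ 3 → ∃ λ e → Unity e × X ≈ tr e v w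
  tr-cover {X} {v} {w} vw≈1 eq = [ (λ p → 1# , unity-1 , trans (+≈0⇒≈ p) (sym (tr-1 v w)))
    , (λ p → [ (λ p → ω , ω³≈1 , +≈0⇒≈ p) , (λ p → ω ^ᶠ 2 , unity-^ 2 ω³≈1 , +≈0⇒≈ p) ]′ (*≈0 p)) ]′
    (*≈0 {X + (v + w)} {(X + tr ω v w) * (X + tr (ω ^ᶠ 2) v w)} (trans
    (solve 4 (λ X v w ω → (X :+ (v :+ w)) :* ((X :+ (ω :* v :+ ω :^ 2 :* w)) :* (X :+ (ω :^ 2 :* v :+ (ω :^ 2) :^ 2 :* w))) :=
      (X :^ 3 :+ X :+ (v :^ 3 :+ w :^ 3))
      :+ (X :^ 2 :* v :+ X :^ 2 :* w :* ω :^ 2 :+ X :^ 2 :* w :* ω :+ X :^ 2 :* w :+ X :* v :^ 2 :* ω :+ X :* v :* w :* ω :^ 3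
        :+ X :* v :* w :* ω :^ 2 :+ X :* v :* w :+ X :* w :^ 2 :* ω :^ 4 :+ X :* w :^ 2 :* ω :^ 3 :+ X :* w :^ 2 :* ω :^ 2
        :+ v :^ 3 :* ω :+ v :^ 3 :+ v :^ 2 :* w :* ω :^ 3 :+ v :* w :^ 2 :* ω :^ 4 :+ w :^ 3 :* ω :^ 4 :+ w :^ 3 :* ω :^ 3
        :+ w :^ 3 :* ω :+ w :^ 3) :* (ω :^ 2 :+ (ω :+ con true))
      :+ X :* (v :* w :+ con true)) refl X v w ω)
    (≈⇒+≈0 eq +≈0 *≈0ʳ _ ω²+ω+1≈0 +≈0 *≈0ʳ _ (≈⇒+≈0 vw≈1))))

  tr≉0 : ∀ {e v w} → Unity e → v * w ≈ 1# → ¬ v ^ᶠ 3 + w ^ᶠ 3 ≈ 0# → ¬ tr e v w ≈ 0#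
  tr≉0 {e} {v} {w} ue vw≈1 ≉0 t≈0 = ≉0 (begin
    v ^ᶠ 3 + w ^ᶠ 3           ≈⟨ tr-cubic ue vw≈1 ⟨
    tr e v w ^ᶠ 3 + tr e v w  ≈⟨ t³≈0 +≈0 t≈0 ⟩
    0#                        ∎)
    where t³≈0 = trans (*-congʳ t≈0) (zeroˡ _)

  tr-injective : ∀ {e f v w} → Unity e → Unity f → v * w ≈ 1# → ¬ v ^ᶠ 3 + w ^ᶠ 3 ≈ 0# →
    tr e v w ≈ tr f v w → e ≈ f
  tr-injective {e} {f} {v} {w} ue uf vw≈1 ≉0 eq with e ≟ f
  ... | yes e≈f = e≈f
  ... | no  e≉f = contradiction (trans
    (solve 4 (λ e f v w → (e :+ f) :* v :+ (e :+ f) :^ 2 :* w := (e :* v :+ e :^ 2 :* w) :+ (f :* v :+ f :^ 2 :* w)) refl e f v w)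
    (≈⇒+≈0 eq)) (tr≉0 (unity-+ ue uf e≉f) vw≈1 ≉0)

  cube-inverse : ∀ {v w d d′} → v * w ≈ 1# → v ^ᶠ 3 ≈ d → d * d′ ≈ 1# → w ^ᶠ 3 ≈ d′
  cube-inverse {v} {w} {d} {d′} vw≈1 v³≈d dd′≈1 = *-cancelˡ (unit≉0ˡ dd′≈1) (begin
    d * w ^ᶠ 3       ≈⟨ *-congʳ v³≈d ⟨
    v ^ᶠ 3 * w ^ᶠ 3  ≈⟨ *-^ v w 3 ⟨
    (v * w) ^ᶠ 3     ≈⟨ ^-cong 3 vw≈1 ⟩
    1# ^ᶠ 3          ≈⟨ 1^ 3 ⟩
    1#               ≈⟨ dd′≈1 ⟨
    d * d′           ∎)

  -- The q-power Frobenius on cube roots.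

  module Frobenius (m : ℕ) where
    φ : Carrier → Carrier
    φ x = x ^ᶠ (2 ^ℕ m)

    φ-cong : ∀ {x y} → x ≈ y → φ x ≈ φ y
    φ-cong = ^-cong (2 ^ℕ m)

    φ-+ : ∀ x y → φ (x + y) ≈ φ x + φ y
    φ-+ = frob-+ m

    φ-* : ∀ x y → φ (x * y) ≈ φ x * φ y
    φ-* x y = *-^ x y (2 ^ℕ m)

    φ-1 : φ 1# ≈ 1#
    φ-1 = 1^ (2 ^ℕ m)

    φ-^ : ∀ k x → φ (x ^ᶠ k) ≈ φ x ^ᶠ k
    φ-^ zero    x = φ-1
    φ-^ (suc k) x = trans (φ-* x (x ^ᶠ k)) (*-congˡ (φ-^ k x))

    φφ : ∀ x → φ (φ x) ≈ x ^ᶠ (4 ^ℕ m)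
    φφ x = begin
      φ (φ x)                     ≈⟨ ^-* x (2 ^ℕ m) (2 ^ℕ m) ⟨
      x ^ᶠ (2 ^ℕ m *ℕ 2 ^ℕ m)     ≡⟨ ≡.cong (λ k → x ^ᶠ (2 ^ℕ m *ℕ k)) (ℕ.*-identityʳ (2 ^ℕ m)) ⟨
      x ^ᶠ ((2 ^ℕ m) ^ℕ 2)        ≡⟨ ≡.cong (x ^ᶠ_) ([2^k]²≡4^k m) ⟩
      x ^ᶠ (4 ^ℕ m)               ∎

    Φ : ℕ → Carrier → Carrier
    Φ j x = x ^ᶠ ((2 ^ℕ m) ^ℕ j)

    Φ-cong : ∀ j {x y} → x ≈ y → Φ j x ≈ Φ j y
    Φ-cong j = ^-cong ((2 ^ℕ m) ^ℕ j)

    Φ-suc : ∀ j x → Φ (suc j) x ≈ Φ j (φ x)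
    Φ-suc j x = ^-* x (2 ^ℕ m) ((2 ^ℕ m) ^ℕ j)

    Φ-+ : ∀ j x y → Φ j (x + y) ≈ Φ j x + Φ j y
    Φ-+ zero    x y = trans (x^1 _) (sym (+-cong (x^1 x) (x^1 y)))
    Φ-+ (suc j) x y = begin
      Φ (suc j) (x + y)         ≈⟨ Φ-suc j (x + y) ⟩
      Φ j (φ (x + y))           ≈⟨ Φ-cong j (φ-+ x y) ⟩
      Φ j (φ x + φ y)           ≈⟨ Φ-+ j (φ x) (φ y) ⟩
      Φ j (φ x) + Φ j (φ y)     ≈⟨ +-cong (Φ-suc j x) (Φ-suc j y) ⟨
      Φ (suc j) x + Φ (suc j) y ∎

    Φ-fixed : ∀ j {x} → φ x ≈ x → Φ j x ≈ x
    Φ-fixed zero    {x} fx = x^1 x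
    Φ-fixed (suc j) {x} fx = trans (Φ-suc j x) (trans (Φ-cong j fx) (Φ-fixed j fx))

    Φ-+ℕ : ∀ i j x → Φ (i +ℕ j) x ≈ Φ j (Φ i x)
    Φ-+ℕ i j x = begin
      x ^ᶠ (q ^ℕ (i +ℕ j))       ≡⟨ ≡.cong (x ^ᶠ_) (ℕ.^-distribˡ-+-* q i j) ⟩
      x ^ᶠ (q ^ℕ i *ℕ q ^ℕ j)    ≈⟨ ^-* x (q ^ℕ i) (q ^ℕ j) ⟩
      Φ j (Φ i x)                ∎
      where q = 2 ^ℕ m

    Φ-multiple : ∀ i j {x} → Φ i x ≈ x → Φ (j *ℕ i) x ≈ x
    Φ-multiple i zero    {x} Φx = x^1 x
    Φ-multiple i (suc j) {x} Φx = trans (Φ-+ℕ i (j *ℕ i) x) (trans (Φ-cong (j *ℕ i) Φx) (Φ-multiple i j Φx))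

    -- Either ω is in F_q and so is `d`, or Frobenius exchanges ω with ω² and takes `d` to `d′`,
    -- which will be its inverse. Which one occurs depends on the parity of `m`.
    Conjugates : Carrier → Carrier → Set
    Conjugates d d′ = (φ ω ≈ ω × φ d ≈ d) ⊎ (φ ω ≈ ω ^ᶠ 2 × φ d ≈ d′)

    φ-unity : ∀ {e} k → φ ω ≈ ω ^ᶠ k → Unity e → φ e ≈ e ^ᶠ k
    φ-unity {e} k φω ue = [ of-power 0 , [ of-power 1 ∘ (λ p → trans p (sym (x^1 ω))) , of-power 2 ]′ ]′ (unity-cases ue)
      where
      of-power : ∀ j → e ≈ ω ^ᶠ j → φ e ≈ e ^ᶠ k
      of-power j e≈ωʲ = begin
        φ e              ≈⟨ φ-cong e≈ωʲ ⟩
        φ (ω ^ᶠ j)       ≈⟨ φ-^ j ω ⟩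
        φ ω ^ᶠ j         ≈⟨ ^-cong j φω ⟩
        (ω ^ᶠ k) ^ᶠ j    ≈⟨ ^-* ω k j ⟨
        ω ^ᶠ (k *ℕ j)    ≡⟨ ≡.cong (ω ^ᶠ_) (ℕ.*-comm k j) ⟩
        ω ^ᶠ (j *ℕ k)    ≈⟨ ^-* ω j k ⟩
        (ω ^ᶠ j) ^ᶠ k    ≈⟨ ^-cong k e≈ωʲ ⟨
        e ^ᶠ k           ∎

    φω-cases : φ ω ≈ ω ⊎ φ ω ≈ ω ^ᶠ 2
    φω-cases = [ (λ φω≈1 → contradiction (1≈0 φω≈1) 1≉0) , (λ p → p) ]′
      (unity-cases (trans (sym (φ-^ 3 ω)) (trans (φ-cong ω³≈1) φ-1)))
      where
      1≈0 : φ ω ≈ 1# → 1# ≈ 0#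
      1≈0 φω≈1 = begin
        1#                        ≈⟨ solve 0 (con true := con true :^ 2 :+ (con true :+ con true)) refl ⟩
        1# ^ᶠ 2 + (1# + 1#)       ≈⟨ +-cong (^-cong 2 φω≈1) (+-cong φω≈1 φ-1) ⟨
        φ ω ^ᶠ 2 + (φ ω + φ 1#)   ≈⟨ +-cong (φ-^ 2 ω) (φ-+ ω 1#) ⟨
        φ (ω ^ᶠ 2) + φ (ω + 1#)   ≈⟨ ≈⇒+≈0 (φ-cong ω²≈ω+1) ⟩
        0#                        ∎

    -- The cubic character of `d` is the factor by which the squared Frobenius moves a cube root:
    -- v^(4^m) = v (v³)^((4^m - 1)/3).
    cube-character : ∀ {v ζ d} → ¬ v ≈ 0# → v ^ᶠ 3 ≈ d → φ (φ v) ≈ ζ * v → d ^ᶠ repunit m ≈ ζ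
    cube-character {v} {ζ} {d} v≉0 v³≈d φφv = *-cancelˡ v≉0 (begin
      v * d ^ᶠ repunit m          ≈⟨ *-congˡ (^-cong (repunit m) v³≈d) ⟨
      v * (v ^ᶠ 3) ^ᶠ repunit m   ≈⟨ *-congˡ (^-* v 3 (repunit m)) ⟨
      v ^ᶠ suc (3 *ℕ repunit m)   ≡⟨ ≡.cong (λ k → v ^ᶠ suc k) (ℕ.*-comm 3 (repunit m)) ⟩
      v ^ᶠ suc (repunit m *ℕ 3)   ≡⟨ ≡.cong (v ^ᶠ_) (repunit-*3 m) ⟩
      v ^ᶠ (4 ^ℕ m)               ≈⟨ φφ v ⟨
      φ (φ v)                     ≈⟨ φφv ⟩
      ζ * v                       ≈⟨ *-comm ζ v ⟩
      v * ζ                       ∎)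

    φ-tr : ∀ {e v w φe φv φw} → φ e ≈ φe → φ v ≈ φv → φ w ≈ φw → φ (tr e v w) ≈ φe * φv + φe ^ᶠ 2 * φw
    φ-tr {e} {v} {w} pe pv pw = trans (φ-+ _ _)
      (+-cong (trans (φ-* e v) (*-cong pe pv)) (trans (φ-* _ w) (*-cong (trans (φ-^ 2 e) (^-cong 2 pe)) pw)))

    φ-inverse : ∀ {v w u u′} → v * w ≈ 1# → φ v ≈ u → u * u′ ≈ 1# → φ w ≈ u′
    φ-inverse {v} {w} {u} {u′} vw≈1 φv uu′ = *-cancelˡ (unit≉0ˡ uu′) (begin
      u * φ w    ≈⟨ *-congʳ φv ⟨
      φ v * φ w  ≈⟨ φ-* v w ⟨
      φ (v * w)  ≈⟨ φ-cong vw≈1 ⟩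
      φ 1#       ≈⟨ φ-1 ⟩
      1#         ≈⟨ uu′ ⟨
      u * u′     ∎)

    twisted-inverse : ∀ {η v w} → Unity η → v * w ≈ 1# → (η * v) * (η ^ᶠ 2 * w) ≈ 1#
    twisted-inverse {η} {v} {w} uη vw≈1 = begin
      (η * v) * (η ^ᶠ 2 * w) ≈⟨ solve 3 (λ η v w → (η :* v) :* (η :^ 2 :* w) := η :^ 3 :* (v :* w)) refl η v w ⟩
      η ^ᶠ 3 * (v * w)       ≈⟨ *-cong uη vw≈1 ⟩
      1# * 1#                ≈⟨ *-identityʳ 1# ⟩
      1#                     ∎

    -- If ω is fixed, φ v = η v with η³ = 1, hence ζ = η² and η = ζ². Otherwise φ v = η w, hence ζ =
    -- η; here φ also squares `e` and interchanges the two summands, so `e` becomes η² e. In both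
    -- cases the label is multiplied by ζ².
    frobenius-tr : ∀ {d d′ v w} → Conjugates d d′ → d * d′ ≈ 1# → v * w ≈ 1# → v ^ᶠ 3 ≈ d →
      let ζ = d ^ᶠ repunit m in
      Unity ζ × φ (φ v) ≈ ζ * v × (∀ {e} → Unity e → φ (tr e v w) ≈ tr (ζ ^ᶠ 2 * e) v w)
    frobenius-tr {d} {d′} {v} {w} (inj₁ (φω , φd)) dd′≈1 vw≈1 v³≈d =
      trans (^-cong 3 ζ≈η²) (unity-^ 2 uη) , trans φφv (*-congʳ (sym ζ≈η²)) , λ {e} ue → begin
        φ (tr e v w)                         ≈⟨ φ-tr (φ-unity′ ue) φv φw ⟩
        e * (η * v) + e ^ᶠ 2 * (η ^ᶠ 2 * w)  ≈⟨ solve 4 (λ e η v w → e :* (η :* v) :+ e :^ 2 :* (η :^ 2 :* w) := (η :* e) :* v :+ (η :* e) :^ 2 :* w) refl e η v w ⟩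
        tr (η * e) v w                       ≈⟨ tr-cong (*-congʳ (trans (sym (unity-4 uη)) (trans (^-* η 2 2) (^-cong 2 (sym ζ≈η²))))) refl refl ⟩
        tr ((d ^ᶠ repunit m) ^ᶠ 2 * e) v w   ∎
      where
      φ-unity′ : ∀ {e} → Unity e → φ e ≈ e
      φ-unity′ ue = trans (φ-unity 1 (trans φω (sym (x^1 ω))) ue) (x^1 _)
      η = φ v * w
      φv : φ v ≈ η * v
      φv = sym (trans (*-assoc _ w v) (trans (*-congˡ (trans (*-comm w v) vw≈1)) (*-identityʳ _)))
      uη : Unity η
      uη = begin
        η ^ᶠ 3                  ≈⟨ *-^ (φ v) w 3 ⟩
        φ v ^ᶠ 3 * w ^ᶠ 3       ≈⟨ *-congʳ (φ-^ 3 v) ⟨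
        φ (v ^ᶠ 3) * w ^ᶠ 3     ≈⟨ *-cong (trans (φ-cong v³≈d) φd) (cube-inverse vw≈1 v³≈d dd′≈1) ⟩
        d * d′                  ≈⟨ dd′≈1 ⟩
        1#                      ∎
      φw : φ w ≈ η ^ᶠ 2 * w
      φw = φ-inverse vw≈1 φv (twisted-inverse uη vw≈1)
      φφv : φ (φ v) ≈ η ^ᶠ 2 * v
      φφv = begin
        φ (φ v)        ≈⟨ φ-cong φv ⟩
        φ (η * v)      ≈⟨ φ-* η v ⟩
        φ η * φ v      ≈⟨ *-cong (φ-unity′ uη) φv ⟩
        η * (η * v)    ≈⟨ solve 2 (λ η v → η :* (η :* v) := η :^ 2 :* v) refl η v ⟩
        η ^ᶠ 2 * v     ∎
      ζ≈η² : d ^ᶠ repunit m ≈ η ^ᶠ 2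
      ζ≈η² = cube-character (unit≉0ˡ vw≈1) v³≈d φφv
    frobenius-tr {d} {d′} {v} {w} (inj₂ (φω , φd)) dd′≈1 vw≈1 v³≈d =
      trans (^-cong 3 ζ≈η) uη , trans φφv (*-congʳ (sym ζ≈η)) , λ {e} ue → begin
        φ (tr e v w)                                ≈⟨ φ-tr (φ-unity 2 φω ue) φv φw ⟩
        e ^ᶠ 2 * (η * w) + (e ^ᶠ 2) ^ᶠ 2 * (η ^ᶠ 2 * v)
          ≈⟨ solve 4 (λ e η v w → e :^ 2 :* (η :* w) :+ (e :^ 2) :^ 2 :* (η :^ 2 :* v) := (η :^ 2 :* e :^ 4) :* v :+ (e :^ 2 :* η) :* w) refl e η v w ⟩
        (η ^ᶠ 2 * e ^ᶠ 4) * v + (e ^ᶠ 2 * η) * w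
          ≈⟨ +-cong (*-congʳ (*-congˡ (unity-4 ue))) (*-congʳ (*-congˡ (sym (unity-4 uη)))) ⟩
        (η ^ᶠ 2 * e) * v + (e ^ᶠ 2 * η ^ᶠ 4) * w
          ≈⟨ solve 4 (λ e η v w → (η :^ 2 :* e) :* v :+ (e :^ 2 :* η :^ 4) :* w := (η :^ 2 :* e) :* v :+ (η :^ 2 :* e) :^ 2 :* w) refl e η v w ⟩
        tr (η ^ᶠ 2 * e) v w                         ≈⟨ tr-cong (*-congʳ (^-cong 2 (sym ζ≈η))) refl refl ⟩
        tr ((d ^ᶠ repunit m) ^ᶠ 2 * e) v w          ∎
      where
      η = φ v * v
      wv≈1 = trans (*-comm w v) vw≈1
      φv : φ v ≈ η * w
      φv = sym (trans (*-assoc _ v w) (trans (*-congˡ vw≈1) (*-identityʳ _)))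
      uη : Unity η
      uη = begin
        η ^ᶠ 3                  ≈⟨ *-^ (φ v) v 3 ⟩
        φ v ^ᶠ 3 * v ^ᶠ 3       ≈⟨ *-congʳ (φ-^ 3 v) ⟨
        φ (v ^ᶠ 3) * v ^ᶠ 3     ≈⟨ *-cong (trans (φ-cong v³≈d) φd) v³≈d ⟩
        d′ * d                  ≈⟨ trans (*-comm d′ d) dd′≈1 ⟩
        1#                      ∎
      φw : φ w ≈ η ^ᶠ 2 * v
      φw = φ-inverse vw≈1 φv (twisted-inverse uη wv≈1)
      φφv : φ (φ v) ≈ η * v
      φφv = begin
        φ (φ v)                    ≈⟨ φ-cong φv ⟩
        φ (η * w)                  ≈⟨ φ-* η w ⟩
        φ η * φ w                  ≈⟨ *-cong (φ-unity 2 φω uη) φw ⟩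
        η ^ᶠ 2 * (η ^ᶠ 2 * v)      ≈⟨ solve 2 (λ η v → η :^ 2 :* (η :^ 2 :* v) := η :^ 4 :* v) refl η v ⟩
        η ^ᶠ 4 * v                 ≈⟨ *-congʳ (unity-4 uη) ⟩
        η * v                      ∎
      ζ≈η : d ^ᶠ repunit m ≈ η
      ζ≈η = cube-character (unit≉0ˡ vw≈1) v³≈d φφv

-- The relation x (y + 1)² = a, its cycles and families of solutions.

module Orbits {n : ℕ} (F : GF2^ n) (n≥1 : 1 ≤ n)
  (ω : GF2^.Carrier F) (ω²≈ω+1 : GeneratesF₄ F ω)
  (m : ℕ) (m≥1 : 1 ≤ m) (n≡6m : n ≡ 6 *ℕ m)
  (a : GF2^.Carrier F) (φa≈a : FieldNotions.InF2^ F m a) (a≉0 : ¬ GF2^._≈_ F a (GF2^.0# F)) where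
  open GF2^ F hiding (zero; distrib)
  open FieldNotions F
  open CubeRootsOfUnity F n≥1 ω ω²≈ω+1 public
  open Frobenius m public
  open import Relation.Binary.Reasoning.Setoid setoid

  s : Carrier
  s = a ⁻¹

  sa≈1 : s * a ≈ 1#
  sa≈1 = inverseˡ a a≉0

  s≉0 : ¬ s ≈ 0#
  s≉0 = unit≉0ˡ sa≈1

  φs≈s : φ s ≈ s
  φs≈s = φ-inverse (inverseʳ a a≉0) φa≈a (inverseʳ a a≉0)

  -- x (y + 1)² = a with a = 1 / s: for y = x ^ (q ^ ℓ) this says that x is a root of X ^ (2 q ^ ℓ + 1) + X + a.
  Rel : Carrier → Carrier → Set
  Rel x y = s * x * (y + 1#) ^ᶠ 2 ≈ 1#

  Rel-cong : ∀ {x x′ y y′} → x ≈ x′ → y ≈ y′ → Rel x y → Rel x′ y′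
  Rel-cong x≈x′ y≈y′ = trans (*-cong (*-congˡ (sym x≈x′)) (^-cong 2 (+-congʳ (sym y≈y′))))

  Rel-functional : ∀ {x y y′} → Rel x y → Rel x y′ → y ≈ y′
  Rel-functional {x} {y} {y′} r r′ = +≈0⇒≈ (trans
    (solve 2 (λ y z → y :+ z := (y :+ con true) :+ (z :+ con true)) refl y y′)
    (≈⇒+≈0 (square-injective (*-cancelˡ (unit≉0ˡ r) (trans r (sym r′))))))

  Rel-Φ : ∀ j {x y} → Rel x y → Rel (Φ j x) (Φ j y)
  Rel-Φ j {x} {y} r = begin
    s * Φ j x * (Φ j y + 1#) ^ᶠ 2     ≈⟨ *-cong (*-congʳ (Φ-fixed j φs≈s)) (^-cong 2 (trans (Φ-+ j y 1#) (+-congˡ (1^ Q)))) ⟨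
    Φ j s * Φ j x * Φ j (y + 1#) ^ᶠ 2 ≈⟨ *-cong (*-^ s x Q) Φ-square ⟨
    Φ j (s * x) * Φ j ((y + 1#) ^ᶠ 2) ≈⟨ *-^ _ _ Q ⟨
    Φ j (s * x * (y + 1#) ^ᶠ 2)       ≈⟨ Φ-cong j r ⟩
    Φ j 1#                            ≈⟨ 1^ Q ⟩
    1#                                ∎
    where
    Q = (2 ^ℕ m) ^ℕ j
    Φ-square : ∀ {z} → Φ j (z ^ᶠ 2) ≈ Φ j z ^ᶠ 2
    Φ-square {z} = trans (*-^ z _ Q) (*-congˡ (trans (*-^ z 1# Q) (*-congˡ (1^ Q))))

  root⇒Rel : ∀ j {x} → x ^ᶠ (2 *ℕ (2 ^ℕ m) ^ℕ j +ℕ 1) + x + a ≈ 0# → Rel x (Φ j x)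
  Rel⇒root : ∀ j {x} → Rel x (Φ j x) → x ^ᶠ (2 *ℕ (2 ^ℕ m) ^ℕ j +ℕ 1) + x + a ≈ 0#

  private
    x^[2Q+1] : ∀ x Q → x ^ᶠ (2 *ℕ Q +ℕ 1) ≈ (x ^ᶠ Q) ^ᶠ 2 * x
    x^[2Q+1] x Q = trans (^-+ x (2 *ℕ Q) 1)
      (*-cong (trans (reflexive (≡.cong (x ^ᶠ_) (ℕ.*-comm 2 Q))) (^-* x Q 2)) (x^1 x))

    s*root : ∀ j x → s * (x ^ᶠ (2 *ℕ (2 ^ℕ m) ^ℕ j +ℕ 1) + x + a) + (s * a + 1#) ≈ s * x * (Φ j x + 1#) ^ᶠ 2 + 1#
    s*root j x = trans (+-congʳ (*-congˡ (+-congʳ (+-congʳ (x^[2Q+1] x ((2 ^ℕ m) ^ℕ j))))))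
      (solve 4 (λ s x y a → s :* (y :^ 2 :* x :+ x :+ a) :+ (s :* a :+ con true) := s :* x :* (y :+ con true) :^ 2 :+ con true)
        refl s x (Φ j x) a)

  root⇒Rel j {x} root = +≈0⇒≈ (trans (sym (s*root j x)) (*≈0ʳ s root +≈0 ≈⇒+≈0 sa≈1))
  Rel⇒root j {x} rel = [ (λ s≈0 → contradiction s≈0 s≉0) , (λ p → p) ]′ (*≈0 {s} (begin
    s * r                     ≈⟨ +-identityʳ _ ⟨
    s * r + 0#                ≈⟨ +-congˡ (≈⇒+≈0 sa≈1) ⟨
    s * r + (s * a + 1#)      ≈⟨ s*root j x ⟩
    s * x * (Φ j x + 1#) ^ᶠ 2 + 1# ≈⟨ ≈⇒+≈0 rel ⟩
    0#                        ∎))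
    where r = x ^ᶠ (2 *ℕ (2 ^ℕ m) ^ℕ j +ℕ 1) + x + a

  -- `Rel x x` expands to the vanishing of this cubic, since x (x + 1)² = x³ + x: its zeros are the
  -- fixed points of the relation.
  Cubic₀ : Carrier → Carrier
  Cubic₀ x = s * x ^ᶠ 3 + s * x + 1#

  -- For the two roots `B` of T² + T + 1 = s² the zeros are the two 3-cycles. Up to the factor B²,
  -- the substitution X = x B + s turns the cubic into s (X³ + X) + B.
  Cubic : Carrier → Carrier → Carrier
  Cubic B x = s * B * x ^ᶠ 3 + s ^ᶠ 2 * x ^ᶠ 2 + s * (B + 1#) * x + B ^ᶠ 2

  Cubic-+ : ∀ B x → Cubic B x + Cubic (B + 1#) x ≈ Cubic₀ x
  Cubic-+ B x = solve 3 (λ s B x →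
      (s :* B :* x :^ 3 :+ s :^ 2 :* x :^ 2 :+ s :* (B :+ con true) :* x :+ B :^ 2)
      :+ (s :* (B :+ con true) :* x :^ 3 :+ s :^ 2 :* x :^ 2 :+ s :* (B :+ con true :+ con true) :* x :+ (B :+ con true) :^ 2)
      := s :* x :^ 3 :+ s :* x :+ con true) refl s B x

  Cubic₀-trace : ∀ x → s * ((x * 1# + 0#) ^ᶠ 3 + (x * 1# + 0#)) + 1# ≈ Cubic₀ x
  Cubic₀-trace x = solve 2 (λ s x → let X = x :* con true :+ con false in
    s :* (X :^ 3 :+ X) :+ con true := s :* x :^ 3 :+ s :* x :+ con true) refl s x

  Cubic-trace : ∀ B x → s ^ᶠ 2 ≈ B ^ᶠ 2 + B + 1# →
    s * ((x * B + s) ^ᶠ 3 + (x * B + s)) + B ≈ B ^ᶠ 2 * Cubic B x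
  Cubic-trace B x s² = +≈0⇒≈ (trans
    (solve 3 (λ s B x → let X = x :* B :+ s in
      s :* (X :^ 3 :+ X) :+ B :+ B :^ 2 :* (s :* B :* x :^ 3 :+ s :^ 2 :* x :^ 2 :+ s :* (B :+ con true) :* x :+ B :^ 2) :=
      (x :* s :* B :+ s :^ 2 :+ B :^ 2 :+ B) :* (s :^ 2 :+ (B :^ 2 :+ B :+ con true))) refl s B x)
    (*≈0ʳ _ (≈⇒+≈0 s²)))

  -- Substituting y = a / (z + 1)² and z = a / (x + 1)² into a = x (y + 1)² leaves a polynomial of degree 9
  -- in x, the product of the three cubics modulo s² = B² + B + 1.
  cycle⇒cubic : ∀ {x y z} B → s ^ᶠ 2 ≈ B ^ᶠ 2 + B + 1# → Rel x y → Rel y z → Rel z x →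
    Cubic₀ x ≈ 0# ⊎ Cubic B x ≈ 0# ⊎ Cubic (B + 1#) x ≈ 0#
  cycle⇒cubic {x} {y} {z} B s² xy yz zx = Sum.map₂ *≈0 (*≈0 (trans
    (solve 3 (λ s B x →
      (s :* x :^ 3 :+ s :* x :+ con true) :*
      ((s :* B :* x :^ 3 :+ s :^ 2 :* x :^ 2 :+ s :* (B :+ con true) :* x :+ B :^ 2)
      :* (s :* (B :+ con true) :* x :^ 3 :+ s :^ 2 :* x :^ 2 :+ s :* (B :+ con true :+ con true) :* x :+ (B :+ con true) :^ 2))
      := (s :* x :* (con true :+ s :* (s :+ con true) :* (x :+ con true) :^ 4) :^ 2 :+ (con true :+ s :* (x :+ con true) :^ 2) :^ 4)
      :+ (s :^ 3 :* x :^ 9 :+ s :^ 3 :* x :^ 7 :+ s :^ 3 :* x :^ 5 :+ s :^ 3 :* x :+ s :^ 2 :+ s :* x :^ 3 :* B :^ 2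
        :+ s :* x :^ 3 :* B :+ s :* x :* B :^ 2 :+ s :* x :* B :+ B :^ 2 :+ B :+ con true)
        :* (s :^ 2 :+ (B :^ 2 :+ B :+ con true))) refl s B x)
    (norm≈0 +≈0 *≈0ʳ _ (≈⇒+≈0 s²))))
    where
    y-eq : y * (1# + s * (x + 1#) ^ᶠ 2) ^ᶠ 2 + s * (x + 1#) ^ᶠ 4 ≈ 0#
    y-eq = trans
      (solve 4 (λ s x y z → y :* (con true :+ s :* (x :+ con true) :^ 2) :^ 2 :+ s :* (x :+ con true) :^ 4 :=
        s :* (x :+ con true) :^ 4 :* (s :* y :* (z :+ con true) :^ 2 :+ con true)
        :+ y :* (s :* z :* (x :+ con true) :^ 2 :+ con true) :* (s :* z :* (x :+ con true) :^ 2 :+ con true)) refl s x y z)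
      (*≈0ʳ _ (≈⇒+≈0 yz) +≈0 *≈0ʳ _ (≈⇒+≈0 zx))
    -- By `y-eq`, y + 1 is a fraction with numerator 1 + s (s + 1) (x + 1)⁴ and denominator (1 + s
    -- (x + 1)²)². This is s x (y + 1)² = 1 with denominators cleared.
    norm≈0 : s * x * (1# + s * (s + 1#) * (x + 1#) ^ᶠ 4) ^ᶠ 2 + (1# + s * (x + 1#) ^ᶠ 2) ^ᶠ 4 ≈ 0#
    norm≈0 = trans
      (solve 3 (λ s x y → let u = y :* (con true :+ s :* (x :+ con true) :^ 2) :^ 2 :+ s :* (x :+ con true) :^ 4 in
        s :* x :* (con true :+ s :* (s :+ con true) :* (x :+ con true) :^ 4) :^ 2 :+ (con true :+ s :* (x :+ con true) :^ 2) :^ 4 :=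
        (con true :+ s :* (x :+ con true) :^ 2) :^ 4 :* (s :* x :* (y :+ con true) :^ 2 :+ con true) :+ s :* x :* u :* u) refl s x y)
      (*≈0ʳ _ (≈⇒+≈0 xy) +≈0 *≈0ʳ _ y-eq)

  -- A family consists of the points (α + v + v⁻¹) β with v³ = d; v ↦ κ v realizes the relation on it.
  record Family : Set where
    field
      κ d d′ α β β′ : Carrier
      κ-unity  : Unity κ
      dd′≈1    : d * d′ ≈ 1#
      d+d′≉0   : ¬ d + d′ ≈ 0#
      ββ′≈1    : β * β′ ≈ 1#
      φα≈α     : φ α ≈ α
      φβ≈β     : φ β ≈ β
      conj     : Conjugates d d′
      relation : ∀ {v w} → v * w ≈ 1# → v ^ᶠ 3 ≈ d → Rel ((α + (v + w)) * β) ((α + tr κ v w) * β)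

    point : Carrier → Carrier → Carrier → Carrier
    point e v w = (α + tr e v w) * β

    Member : Carrier → Set
    Member x = ∃ λ v → ∃ λ w → v * w ≈ 1# × v ^ᶠ 3 ≈ d × x ≈ (α + (v + w)) * β

    ζ : Carrier
    ζ = d ^ᶠ repunit m

    Selected : ℕ → Set
    Selected ℓ = (ζ ^ᶠ 2) ^ᶠ ℓ ≈ κ

    d≉0 : ¬ d ≈ 0#
    d≉0 = unit≉0ˡ dd′≈1

    d-fixed : d ^ᶠ (4 ^ℕ m) ≈ d
    d-fixed = trans (sym (φφ d)) ([ (λ (_ , φd) → trans (φ-cong φd) φd)
      , (λ (_ , φd) → trans (φ-cong φd) (φ-inverse dd′≈1 φd (trans (*-comm d′ d) dd′≈1))) ]′ conj)

    cube-root : ∃ λ v → v ^ᶠ 3 ≈ d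
    cube-root = subfield-cube m m≥1 n≡6m d≉0 d-fixed

    root-unit : ∀ {v} → v ^ᶠ 3 ≈ d → v * v ⁻¹ ≈ 1#
    root-unit {v} v³≈d = inverseʳ v λ v≈0 → d≉0 (trans (sym v³≈d) (trans (*-congʳ v≈0) (zeroˡ _)))

    v³+w³ : ∀ {v w} → v * w ≈ 1# → v ^ᶠ 3 ≈ d → v ^ᶠ 3 + w ^ᶠ 3 ≈ d + d′
    v³+w³ vw≈1 v³≈d = +-cong v³≈d (cube-inverse vw≈1 v³≈d dd′≈1)

    affine-injective : ∀ {X Y} → (α + X) * β ≈ (α + Y) * β → X ≈ Y
    affine-injective {X} {Y} eq = +≈0⇒≈ (trans (solve 3 (λ α X Y → X :+ Y := α :+ X :+ (α :+ Y)) refl α X Y)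
      (≈⇒+≈0 (*-cancelˡ (unit≉0ˡ ββ′≈1) (trans (*-comm _ _) (trans eq (*-comm _ _))))))

    point-injective : ∀ {e f v w} → Unity e → Unity f → v * w ≈ 1# → v ^ᶠ 3 ≈ d → point e v w ≈ point f v w → e ≈ f
    point-injective ue uf vw≈1 v³≈d eq = tr-injective ue uf vw≈1
      (λ p → d+d′≉0 (trans (sym (v³+w³ vw≈1 v³≈d)) p)) (affine-injective eq)

    point-1 : ∀ v w → point 1# v w ≈ (α + (v + w)) * β
    point-1 v w = *-congʳ (+-congˡ (tr-1 v w))

    point-member : ∀ {e v w} → Unity e → v * w ≈ 1# → v ^ᶠ 3 ≈ d → Member (point e v w)
    point-member {e} {v} {w} ue vw≈1 v³≈d = e * v , e ^ᶠ 2 * w , twisted-inverse ue vw≈1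
      , trans (*-^ e v 3) (trans (*-cong ue v³≈d) (*-identityˡ d)) , refl

    cubic⇒point : ∀ {v w X} → v * w ≈ 1# → v ^ᶠ 3 ≈ d → X ^ᶠ 3 + X ≈ d + d′ →
      ∃ λ e → Unity e × (α + X) * β ≈ point e v w
    cubic⇒point vw≈1 v³≈d eq =
      Product.map₂ (Product.map₂ λ X≈tr → *-congʳ (+-congˡ X≈tr)) (tr-cover vw≈1 (trans eq (sym (v³+w³ vw≈1 v³≈d))))

    member-cong : ∀ {x y} → x ≈ y → Member x → Member y
    member-cong x≈y (v , w , vw≈1 , v³≈d , x≈) = v , w , vw≈1 , v³≈d , trans (sym x≈y) x≈

    cubic⇒member : ∀ {x} → (x * β′ + α) ^ᶠ 3 + (x * β′ + α) ≈ d + d′ → Member x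
    cubic⇒member {x} eq = member-cong point≈x (point-member ue vw≈1 (proj₂ cube-root))
      where
      vw≈1 = root-unit (proj₂ cube-root)
      on-orbit = cubic⇒point vw≈1 (proj₂ cube-root) eq
      ue = proj₁ (proj₂ on-orbit)
      point≈x : point (proj₁ on-orbit) (proj₁ cube-root) (proj₁ cube-root ⁻¹) ≈ x
      point≈x = begin
        point (proj₁ on-orbit) (proj₁ cube-root) (proj₁ cube-root ⁻¹) ≈⟨ proj₂ (proj₂ on-orbit) ⟨
        (α + (x * β′ + α)) * β   ≈⟨ solve 4 (λ α x β β′ → (α :+ (x :* β′ :+ α)) :* β := x :* (β :* β′)) refl α x β β′ ⟩
        x * (β * β′)             ≈⟨ *-congˡ ββ′≈1 ⟩
        x * 1#                   ≈⟨ *-identityʳ x ⟩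
        x                        ∎

    member⇒cubic : ∀ {x} → Member x → (x * β′ + α) ^ᶠ 3 + (x * β′ + α) ≈ d + d′
    member⇒cubic {x} (v , w , vw≈1 , v³≈d , x≈) = begin
      X ^ᶠ 3 + X                   ≈⟨ +-cong (^-cong 3 X≈tr) X≈tr ⟩
      tr 1# v w ^ᶠ 3 + tr 1# v w   ≈⟨ tr-cubic unity-1 vw≈1 ⟩
      v ^ᶠ 3 + w ^ᶠ 3              ≈⟨ v³+w³ vw≈1 v³≈d ⟩
      d + d′                       ∎
      where
      X = x * β′ + α
      X≈tr : X ≈ tr 1# v w
      X≈tr = begin
        x * β′ + α                         ≈⟨ +-congʳ (*-congʳ x≈) ⟩
        (α + (v + w)) * β * β′ + α         ≈⟨ solve 5 (λ α v w β β′ → (α :+ (v :+ w)) :* β :* β′ :+ α := (α :+ (v :+ w)) :* (β :* β′) :+ α) refl α v w β β′ ⟩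
        (α + (v + w)) * (β * β′) + α       ≈⟨ +-congʳ (*-congˡ ββ′≈1) ⟩
        (α + (v + w)) * 1# + α             ≈⟨ solve 3 (λ α v w → (α :+ (v :+ w)) :* con true :+ α := con true :* v :+ con true :^ 2 :* w) refl α v w ⟩
        tr 1# v w                          ∎

    size3 : HasSize3 Member
    size3 = point 1# v w , point ω v w , point (ω ^ᶠ 2) v w
      , (λ eq → ω≉1 (sym (inj unity-1 ω³≈1 eq)))
      , (λ eq → ω²≉1 (sym (inj unity-1 (unity-^ 2 ω³≈1) eq)))
      , (λ eq → ω²≉ω (sym (inj ω³≈1 (unity-^ 2 ω³≈1) eq)))
      , λ x → covered , [ back unity-1 , [ back ω³≈1 , back (unity-^ 2 ω³≈1) ]′ ]′
      where
      v = proj₁ cube-root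
      w = v ⁻¹
      v³≈d = proj₂ cube-root
      vw≈1 = root-unit v³≈d
      inj : ∀ {e f} → Unity e → Unity f → point e v w ≈ point f v w → e ≈ f
      inj ue uf = point-injective ue uf vw≈1 v³≈d
      back : ∀ {e x} → Unity e → x ≈ point e v w → Member x
      back ue x≈ = member-cong (sym x≈) (point-member ue vw≈1 v³≈d)
      covered : ∀ {x} → Member x → x ≈ point 1# v w ⊎ x ≈ point ω v w ⊎ x ≈ point (ω ^ᶠ 2) v w
      covered {x} (v′ , w′ , v′w′≈1 , v′³≈d , x≈) = Sum.map at (Sum.map at at) (unity-cases (proj₁ (proj₂ p)))
        where
        p = cubic⇒point vw≈1 v³≈d (trans (tr-cubic unity-1 v′w′≈1) (v³+w³ v′w′≈1 v′³≈d))
        at : ∀ {f} → proj₁ p ≈ f → x ≈ point f v w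
        at e≈f = trans x≈ (trans (sym (point-1 v′ w′)) (trans (proj₂ (proj₂ p)) (*-congʳ (+-congˡ (tr-cong e≈f refl refl)))))

    ζ-unity : Unity ζ
    ζ-unity = proj₁ (frobenius-tr conj dd′≈1 (root-unit (proj₂ cube-root)) (proj₂ cube-root))

    cube-root-conjugate : φ (φ (proj₁ cube-root)) ≈ ζ * proj₁ cube-root
    cube-root-conjugate = proj₁ (proj₂ (frobenius-tr conj dd′≈1 (root-unit (proj₂ cube-root)) (proj₂ cube-root)))

    cube⇒ζ≈1 : ∀ {y} → φ (φ y) ≈ y → y ^ᶠ 3 ≈ d → ζ ≈ 1#
    cube⇒ζ≈1 {y} y-fixed y³≈d = cube-character (unit≉0ˡ (root-unit y³≈d)) y³≈d (trans y-fixed (sym (*-identityˡ y)))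

    Φ-point : ∀ j {e v w} → Unity e → v * w ≈ 1# → v ^ᶠ 3 ≈ d → Φ j (point e v w) ≈ point ((ζ ^ᶠ 2) ^ᶠ j * e) v w
    Φ-point zero    {e} ue vw≈1 v³≈d = trans (x^1 _) (*-congʳ (+-congˡ (tr-cong (sym (*-identityˡ e)) refl refl)))
    Φ-point (suc j) {e} {v} {w} ue vw≈1 v³≈d = begin
      Φ (suc j) (point e v w)                       ≈⟨ Φ-suc j _ ⟩
      Φ j (φ (point e v w))                         ≈⟨ Φ-cong j (begin
        φ ((α + tr e v w) * β)                        ≈⟨ φ-* _ β ⟩
        φ (α + tr e v w) * φ β                        ≈⟨ *-cong (φ-+ α _) φβ≈β ⟩
        (φ α + φ (tr e v w)) * β                      ≈⟨ *-congʳ (+-cong φα≈α (proj₂ (proj₂ (frobenius-tr conj dd′≈1 vw≈1 v³≈d)) ue)) ⟩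
        point (ζ ^ᶠ 2 * e) v w                        ∎) ⟩
      Φ j (point (ζ ^ᶠ 2 * e) v w)                  ≈⟨ Φ-point j (unity-* (unity-^ 2 ζ-unity) ue) vw≈1 v³≈d ⟩
      point ((ζ ^ᶠ 2) ^ᶠ j * (ζ ^ᶠ 2 * e)) v w      ≈⟨ *-congʳ (+-congˡ (tr-cong (trans (sym (*-assoc _ _ e)) (*-congʳ (*-comm _ _))) refl refl)) ⟩
      point ((ζ ^ᶠ 2) ^ᶠ suc j * e) v w             ∎

    private
      Φ-base : ∀ j {v w} → v * w ≈ 1# → v ^ᶠ 3 ≈ d → Φ j ((α + (v + w)) * β) ≈ point ((ζ ^ᶠ 2) ^ᶠ j) v w
      Φ-base j {v} {w} vw≈1 v³≈d = trans (Φ-cong j (sym (point-1 v w)))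
        (trans (Φ-point j unity-1 vw≈1 v³≈d) (*-congʳ (+-congˡ (tr-cong (*-identityʳ _) refl refl))))

    member-fixed : ∀ {x} → Member x → Φ 3 x ≈ x
    member-fixed {x} (v , w , vw≈1 , v³≈d , x≈) = begin
      Φ 3 x                           ≈⟨ Φ-cong 3 x≈ ⟩
      Φ 3 ((α + (v + w)) * β)         ≈⟨ Φ-base 3 vw≈1 v³≈d ⟩
      point ((ζ ^ᶠ 2) ^ᶠ 3) v w       ≈⟨ *-congʳ (+-congˡ (tr-cong (unity-^ 2 ζ-unity) refl refl)) ⟩
      point 1# v w                    ≈⟨ point-1 v w ⟩
      (α + (v + w)) * β               ≈⟨ x≈ ⟨
      x                               ∎

    selected⇒Rel : ∀ ℓ {x} → Selected ℓ → Member x → Rel x (Φ ℓ x)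
    selected⇒Rel ℓ {x} sel (v , w , vw≈1 , v³≈d , x≈) = Rel-cong (sym x≈) (begin
      point κ v w                     ≈⟨ *-congʳ (+-congˡ (tr-cong (sym sel) refl refl)) ⟩
      point ((ζ ^ᶠ 2) ^ᶠ ℓ) v w       ≈⟨ Φ-base ℓ vw≈1 v³≈d ⟨
      Φ ℓ ((α + (v + w)) * β)         ≈⟨ Φ-cong ℓ x≈ ⟨
      Φ ℓ x                           ∎) (relation vw≈1 v³≈d)

    -- Successors are unique, so the conjugate of `x`, with label ζ^(2ℓ), is the successor given by
    -- `relation`, with label `κ`. The conclusion no longer mentions `x`: one point of a family in Γ
    -- brings in the whole family.
    Rel⇒selected : ∀ ℓ {x} → Member x → Rel x (Φ ℓ x) → Selected ℓ
    Rel⇒selected ℓ {x} (v , w , vw≈1 , v³≈d , x≈) rel =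
      point-injective (unity-^ ℓ (unity-^ 2 ζ-unity)) κ-unity vw≈1 v³≈d
        (Rel-functional (Rel-cong x≈ (trans (Φ-cong ℓ x≈) (Φ-base ℓ vw≈1 v³≈d)) rel) (relation vw≈1 v³≈d))

    -- A family with `κ` different from 1 contains no fixed point of the relation. This keeps Λ₁ and
    -- Λ₂ away from Λ₀.
    Rel-diagonal : ∀ {x} → Member x → Rel x x → κ ≈ 1#
    Rel-diagonal {x} (v , w , vw≈1 , v³≈d , x≈) rel =
      point-injective κ-unity unity-1 vw≈1 v³≈d
        (Rel-functional (relation vw≈1 v³≈d) (Rel-cong x≈ (trans x≈ (sym (point-1 v w))) rel))

-- With ℓ ≡ l, m ≡ μ and c ^ ((q² - 1) / 3) = ω ^ ρ, the roots in Λ_j lie in Γ exactly when Selects l μ ρ j.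
Selects : Fin 3 → Fin 3 → Fin 3 → Fin 3 → Set
Selects l μ ρ j = ((toℕ j *ℕ toℕ μ +ℕ toℕ ρ) *ℕ 2 *ℕ toℕ l) % 3 ≡ toℕ j

SelectsOnly : Fin 3 → Fin 3 → Fin 3 → ℕ → Set
SelectsOnly l μ ρ k = ∀ j → (Selects l μ ρ j → toℕ j ≡ k) × (toℕ j ≡ k → Selects l μ ρ j)

private
  selects? : ∀ l μ ρ j → Dec (Selects l μ ρ j)
  selects? l μ ρ j = ((toℕ j *ℕ toℕ μ +ℕ toℕ ρ) *ℕ 2 *ℕ toℕ l) % 3 ℕ.≟ toℕ j

  selectsOnly? : ∀ l μ ρ k → Dec (SelectsOnly l μ ρ k)
  selectsOnly? l μ ρ k = all? λ j → (selects? l μ ρ j →-dec toℕ j ℕ.≟ k) ×-dec (toℕ j ℕ.≟ k →-dec selects? l μ ρ j)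

-- The congruences modulo 3, decided by running through all residues.

abstract
  selection-cube : ∀ l μ ρ → toℕ μ ≡ 0 → toℕ ρ % 3 ≡ 0 → SelectsOnly l μ ρ 0
  selection-cube = toWitness {a? = all? λ l → all? λ μ → all? λ ρ →
    toℕ μ ℕ.≟ 0 →-dec toℕ ρ % 3 ℕ.≟ 0 →-dec selectsOnly? l μ ρ 0} _

  -- For μ = 0 the index `j` is selected when 2 ρ l ≡ j. Since l² ≡ 1, the condition ρ ≡ 2 k l on
  -- the character is the same as k ≡ 2 ρ l, so `k` is the selected index.
  selection-noncube : ∀ l μ ρ → toℕ l ≢ 0 → toℕ μ ≡ 0 → toℕ ρ % 3 ≢ 0 → ∃ λ (k : Fin 3) →
    toℕ k ≢ 0 × toℕ ρ % 3 ≡ (2 *ℕ (toℕ k *ℕ toℕ l)) % 3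
    × (∀ (k′ : Fin 3) → toℕ k′ ≢ 0 → toℕ ρ % 3 ≡ (2 *ℕ (toℕ k′ *ℕ toℕ l)) % 3 → toℕ k′ ≡ toℕ k)
    × SelectsOnly l μ ρ (toℕ k)
  selection-noncube = toWitness {a? = all? λ l → all? λ μ → all? λ ρ →
    ¬? (toℕ l ℕ.≟ 0) →-dec toℕ μ ℕ.≟ 0 →-dec ¬? (toℕ ρ % 3 ℕ.≟ 0) →-dec any? λ k →
    ¬? (toℕ k ℕ.≟ 0) ×-dec toℕ ρ % 3 ℕ.≟ (2 *ℕ (toℕ k *ℕ toℕ l)) % 3
    ×-dec (all? λ (k′ : Fin 3) → ¬? (toℕ k′ ℕ.≟ 0) →-dec toℕ ρ % 3 ℕ.≟ (2 *ℕ (toℕ k′ *ℕ toℕ l)) % 3 →-dec toℕ k′ ℕ.≟ toℕ k)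
    ×-dec selectsOnly? l μ ρ (toℕ k)} _

  -- Here μ² ≡ 1, so k ≡ -ρ μ. For l ≡ μ the selection 2 j + 2 ρ μ ≡ j means j ≡ ρ μ ≡ -k, whence
  -- the index 3 - k. For l ≡ -μ it reads j + ρ μ ≡ j, which does not depend on `j`: all indices are
  -- selected if ρ = 0, that is k = 0, and none otherwise.
  selection-3∤m : ∀ l μ ρ → toℕ μ ≢ 0 → ∃ λ (k : Fin 3) →
    (toℕ k *ℕ toℕ μ +ℕ toℕ ρ) % 3 ≡ 0
    × (∀ (k′ : Fin 3) → (toℕ k′ *ℕ toℕ μ +ℕ toℕ ρ) % 3 ≡ 0 → toℕ k′ ≡ toℕ k)
    × (toℕ k ≡ 0 → toℕ l ≡ toℕ μ → SelectsOnly l μ ρ 0)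
    × (toℕ k ≢ 0 → toℕ l ≡ toℕ μ → SelectsOnly l μ ρ (3 ∸ toℕ k))
    × (toℕ k ≡ 0 → (toℕ l +ℕ toℕ μ) % 3 ≡ 0 → ∀ j → Selects l μ ρ j)
    × (toℕ k ≢ 0 → (toℕ l +ℕ toℕ μ) % 3 ≡ 0 → ∀ j → ¬ Selects l μ ρ j)
  selection-3∤m = toWitness {a? = all? λ l → all? λ μ → all? λ ρ → ¬? (toℕ μ ℕ.≟ 0) →-dec any? λ k →
    (toℕ k *ℕ toℕ μ +ℕ toℕ ρ) % 3 ℕ.≟ 0
    ×-dec (all? λ (k′ : Fin 3) → (toℕ k′ *ℕ toℕ μ +ℕ toℕ ρ) % 3 ℕ.≟ 0 →-dec toℕ k′ ℕ.≟ toℕ k)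
    ×-dec (toℕ k ℕ.≟ 0 →-dec toℕ l ℕ.≟ toℕ μ →-dec selectsOnly? l μ ρ 0)
    ×-dec (¬? (toℕ k ℕ.≟ 0) →-dec toℕ l ℕ.≟ toℕ μ →-dec selectsOnly? l μ ρ (3 ∸ toℕ k))
    ×-dec (toℕ k ℕ.≟ 0 →-dec (toℕ l +ℕ toℕ μ) % 3 ℕ.≟ 0 →-dec all? λ j → selects? l μ ρ j)
    ×-dec (¬? (toℕ k ℕ.≟ 0) →-dec (toℕ l +ℕ toℕ μ) % 3 ℕ.≟ 0 →-dec all? λ j → ¬? (selects? l μ ρ j))} _

F₄-generator : ∀ {n} (F : GF2^ n) → 1 ≤ n →
  let open GF2^ F in
  let open FieldNotions F in
  ∀ {ω} → InF2^ 2 ω → ¬ ω ≈ 0# → ¬ ω ≈ 1# → GeneratesF₄ F ω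
F₄-generator F n≥1 {ω} ω⁴≈ω ω≉0 ω≉1 = [ (λ p → contradiction p ω≉0)
  , (λ p → [ (λ p′ → contradiction (+≈0⇒≈ p′) ω≉1) , +≈0⇒≈ ]′ (*≈0 p)) ]′
  (*≈0 {ω} {(ω + 1#) * (ω ^ᶠ 2 + (ω + 1#))} (trans
    (solve 1 (λ ω → ω :* ((ω :+ con true) :* (ω :^ 2 :+ (ω :+ con true))) := ω :^ 4 :+ ω) refl ω)
    (≈⇒+≈0 ω⁴≈ω)))
  where
  open GF2^ F
  open FieldNotions F
  open Char2 F n≥1

ArtinSchreier : ∀ {n} (F : GF2^ n) (a b : GF2^.Carrier F) → Set
ArtinSchreier F a b = b ^ᶠ 2 + b ≈ a ⁻¹ + 1#
  where
  open GF2^ F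
  open FieldNotions F

-- The three families attached to c, ω c and ω² c.

module Families (m : ℕ) (m≥1 : 1 ≤ m) (F : GF2^ (6 *ℕ m))
  (a : GF2^.Carrier F) (φa≈a : FieldNotions.InF2^ F m a)
  (a≉0 : ¬ GF2^._≈_ F a (GF2^.0# F)) (a≉1 : ¬ GF2^._≈_ F a (GF2^.1# F))
  (ω : GF2^.Carrier F) (ω²≈ω+1 : GeneratesF₄ F ω)
  (b : GF2^.Carrier F) (φb≈b : FieldNotions.InF2^ F m b) (b-eq : ArtinSchreier F a b) where
  open GF2^ F hiding (zero; distrib)
  open FieldNotions F

  n≥1 : 1 ≤ 6 *ℕ m
  n≥1 = ℕ.≤-trans m≥1 (ℕ.m≤m+n m _)

  open Orbits F n≥1 ω ω²≈ω+1 m m≥1 ≡.refl a φa≈a a≉0 public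
  open import Relation.Binary.Reasoning.Setoid setoid

  s-eq : s ≈ b ^ᶠ 2 + b + 1#
  s-eq = +≈0⇒≈ (trans (solve 2 (λ s t → s :+ (t :+ con true) := t :+ (s :+ con true)) refl s (b ^ᶠ 2 + b)) (≈⇒+≈0 b-eq))

  b∉F₄ : ¬ InF2^ 2 b
  b∉F₄ b⁴≈b = [ (λ p → a≉1 (begin
      a          ≈⟨ *-identityˡ a ⟨
      1# * a     ≈⟨ *-congʳ (+≈0⇒≈ p) ⟨
      s * a      ≈⟨ sa≈1 ⟩
      1#         ∎)) , s≉0 ]′
    (*≈0 (begin
      (s + 1#) * s                   ≈⟨ *-cong (sym b-eq) s-eq ⟩
      (b ^ᶠ 2 + b) * (b ^ᶠ 2 + b + 1#) ≈⟨ solve 1 (λ b → (b :^ 2 :+ b) :* (b :^ 2 :+ b :+ con true) := b :^ 4 :+ b) refl b ⟩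
      b ^ᶠ 4 + b                     ≈⟨ ≈⇒+≈0 b⁴≈b ⟩
      0#                             ∎))

  b≉0 : ¬ b ≈ 0#
  b≉0 b≈0 = b∉F₄ (trans (^-cong 4 b≈0) (trans (frob-0 2) (sym b≈0)))

  b≉1 : ¬ b ≈ 1#
  b≉1 b≈1 = b∉F₄ (trans (^-cong 4 b≈1) (trans (1^ 4) (sym b≈1)))

  B = b ^ᶠ 2
  u = b + ω
  u′ = b + ω ^ᶠ 2
  c = u /ᶠ u′
  c′ = u′ /ᶠ u

  B≉0 : ¬ B ≈ 0#
  B≉0 = ^≉0 2 b≉0

  B+1≉0 : ¬ B + 1# ≈ 0#
  B+1≉0 p = b≉1 (square-injective (trans (+≈0⇒≈ p) (sym (1^ 2))))

  s²-eq : s ^ᶠ 2 ≈ B ^ᶠ 2 + B + 1#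
  s²-eq = trans (^-cong 2 s-eq) (solve 1 (λ b → (b :^ 2 :+ b :+ con true) :^ 2 := (b :^ 2) :^ 2 :+ b :^ 2 :+ con true) refl b)

  private
    uu′≈s : u * u′ ≈ s
    uu′≈s = trans (+≈0⇒≈ (trans
      (solve 2 (λ b ω → (b :+ ω) :* (b :+ ω :^ 2) :+ (b :^ 2 :+ b :+ con true) :=
        b :* (ω :^ 2 :+ (ω :+ con true)) :+ (ω :^ 3 :+ con true)) refl b ω)
      (*≈0ʳ b ω²+ω+1≈0 +≈0 ≈⇒+≈0 ω³≈1))) (sym s-eq)

    u≉0 : ¬ u ≈ 0#
    u≉0 u≈0 = s≉0 (trans (sym uu′≈s) (trans (*-congʳ u≈0) (zeroˡ _)))

    u′≉0 : ¬ u′ ≈ 0#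
    u′≉0 u′≈0 = s≉0 (trans (sym uu′≈s) (trans (*-congˡ u′≈0) (zeroʳ _)))

  -- As u u′ = s, the quotient c = u / u′ is u² / s. Multiplying by `s` thus makes every statement
  -- about `c` polynomial in `b` and `ω`.
  sc≈u² : s * c ≈ u ^ᶠ 2
  sc≈u² = begin
    s * (u * u′ ⁻¹)        ≈⟨ *-congʳ uu′≈s ⟨
    u * u′ * (u * u′ ⁻¹)   ≈⟨ solve 3 (λ x y z → x :* y :* (x :* z) := x :^ 2 :* (y :* z)) refl u u′ (u′ ⁻¹) ⟩
    u ^ᶠ 2 * (u′ * u′ ⁻¹)  ≈⟨ *-congˡ (inverseʳ u′ u′≉0) ⟩
    u ^ᶠ 2 * 1#            ≈⟨ *-identityʳ _ ⟩
    u ^ᶠ 2                 ∎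

  sc′≈u′² : s * c′ ≈ u′ ^ᶠ 2
  sc′≈u′² = begin
    s * (u′ * u ⁻¹)        ≈⟨ *-congʳ uu′≈s ⟨
    u * u′ * (u′ * u ⁻¹)   ≈⟨ solve 3 (λ x y z → x :* y :* (y :* z) := y :^ 2 :* (x :* z)) refl u u′ (u ⁻¹) ⟩
    u′ ^ᶠ 2 * (u * u ⁻¹)   ≈⟨ *-congˡ (inverseʳ u u≉0) ⟩
    u′ ^ᶠ 2 * 1#           ≈⟨ *-identityʳ _ ⟩
    u′ ^ᶠ 2                ∎

  cc′≈1 : c * c′ ≈ 1#
  cc′≈1 = begin
    u * u′ ⁻¹ * (u′ * u ⁻¹)     ≈⟨ solve 4 (λ x y z t → x :* y :* (z :* t) := x :* t :* (z :* y)) refl u (u′ ⁻¹) u′ (u ⁻¹) ⟩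
    u * u ⁻¹ * (u′ * u′ ⁻¹)     ≈⟨ *-cong (inverseʳ u u≉0) (inverseʳ u′ u′≉0) ⟩
    1# * 1#                     ≈⟨ *-identityʳ 1# ⟩
    1#                          ∎

  c-conjugates : Conjugates c c′
  c-conjugates = Sum.map (λ φω → φω , *-cancelˡ s≉0 (begin
      s * φ c         ≈⟨ sφc ⟩
      φ u ^ᶠ 2        ≈⟨ ^-cong 2 (trans (φ-+ b ω) (+-cong φb≈b φω)) ⟩
      u ^ᶠ 2          ≈⟨ sc≈u² ⟨
      s * c           ∎))
    (λ φω → φω , *-cancelˡ s≉0 (begin
      s * φ c         ≈⟨ sφc ⟩
      φ u ^ᶠ 2        ≈⟨ ^-cong 2 (trans (φ-+ b ω) (+-cong φb≈b φω)) ⟩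
      u′ ^ᶠ 2         ≈⟨ sc′≈u′² ⟨
      s * c′          ∎)) φω-cases
    where
    sφc : s * φ c ≈ φ u ^ᶠ 2
    sφc = begin
      s * φ c         ≈⟨ *-congʳ φs≈s ⟨
      φ s * φ c       ≈⟨ φ-* s c ⟨
      φ (s * c)       ≈⟨ φ-cong sc≈u² ⟩
      φ (u ^ᶠ 2)      ≈⟨ φ-^ 2 u ⟩
      φ u ^ᶠ 2        ∎

  scaled-conjugates : ∀ {κ} → Unity κ → Conjugates (κ * c) (κ ^ᶠ 2 * c′)
  scaled-conjugates {κ} uκ = Sum.map
    (λ (φω , φc) → φω , trans (φ-* κ c) (*-cong (trans (φ-unity 1 (trans φω (sym (x^1 ω))) uκ) (x^1 κ)) φc))
    (λ (φω , φc) → φω , trans (φ-* κ c) (*-cong (φ-unity 2 φω uκ) φc))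
    c-conjugates

  scaled-inverse : ∀ {κ} → Unity κ → (κ * c) * (κ ^ᶠ 2 * c′) ≈ 1#
  scaled-inverse uκ = twisted-inverse uκ cc′≈1

  s*scaled : ∀ κ → s * (κ * c) ≈ κ * u ^ᶠ 2
  s*scaled κ = trans (solve 3 (λ s κ c → s :* (κ :* c) := κ :* (s :* c)) refl s κ c) (*-congˡ sc≈u²)

  s*scaled′ : ∀ κ → s * (κ * c′) ≈ κ * u′ ^ᶠ 2
  s*scaled′ κ = trans (solve 3 (λ s κ c → s :* (κ :* c) := κ :* (s :* c)) refl s κ c′) (*-congˡ sc′≈u′²)

  private
    s[d+d′]≉0 : ∀ {d d′ e} → s * (d + d′) ≈ e → ¬ e ≈ 0# → ¬ d + d′ ≈ 0#
    s[d+d′]≉0 eq e≉0 p = e≉0 (trans (sym eq) (*≈0ʳ s p))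

    φ-fixes-+ : ∀ {x y} → φ x ≈ x → φ y ≈ y → φ (x + y) ≈ x + y
    φ-fixes-+ {x} {y} p q = trans (φ-+ x y) (+-cong p q)

    φ-⁻¹ : ∀ {x} → ¬ x ≈ 0# → φ x ≈ x → φ (x ⁻¹) ≈ x ⁻¹
    φ-⁻¹ {x} x≉0 p = φ-inverse (inverseʳ x x≉0) p (inverseʳ x x≉0)

    φB≈B : φ B ≈ B
    φB≈B = trans (φ-^ 2 b) (^-cong 2 φb≈b)

  -- For the three families s (d + d′) is 1, B and B + 1: exactly the constants in `Cubic₀-trace`
  -- and `Cubic-trace`, which is how the cubics are matched with the families.
  s[c+c′] : s * (c + c′) ≈ 1#
  s[c+c′] = begin
    s * (c + c′)        ≈⟨ distribˡ s c c′ ⟩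
    s * c + s * c′      ≈⟨ +-cong sc≈u² sc′≈u′² ⟩
    u ^ᶠ 2 + u′ ^ᶠ 2    ≈⟨ +≈0⇒≈ (trans
      (solve 2 (λ b ω → (b :+ ω) :^ 2 :+ (b :+ ω :^ 2) :^ 2 :+ con true := (ω :^ 2 :+ (ω :+ con true)) :* (ω :^ 2 :+ (ω :+ con true)) :+ con false) refl b ω)
      (*≈0ʳ _ ω²+ω+1≈0 +≈0 refl)) ⟩
    1#                  ∎

  s[ωc+ω²c′] : s * (ω * c + ω ^ᶠ 2 * c′) ≈ B
  s[ωc+ω²c′] = trans (distribˡ s _ _) (trans (+-cong (s*scaled ω) (s*scaled′ (ω ^ᶠ 2))) (+≈0⇒≈ (trans
    (solve 2 (λ b ω → ω :* (b :+ ω) :^ 2 :+ ω :^ 2 :* (b :+ ω :^ 2) :^ 2 :+ b :^ 2 :=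
      b :^ 2 :* (ω :^ 2 :+ (ω :+ con true)) :+ ω :^ 3 :* (ω :^ 3 :+ con true)) refl b ω)
    (*≈0ʳ _ ω²+ω+1≈0 +≈0 *≈0ʳ _ (≈⇒+≈0 ω³≈1)))))

  s[ω²c+ωc′] : s * (ω ^ᶠ 2 * c + (ω ^ᶠ 2) ^ᶠ 2 * c′) ≈ B + 1#
  s[ω²c+ωc′] = trans (distribˡ s _ _) (trans (+-cong (s*scaled (ω ^ᶠ 2)) (s*scaled′ ((ω ^ᶠ 2) ^ᶠ 2))) (+≈0⇒≈ (trans
    (solve 2 (λ b ω → let h = ω :^ 2 :+ (ω :+ con true) in
      ω :^ 2 :* (b :+ ω) :^ 2 :+ (ω :^ 2) :^ 2 :* (b :+ ω :^ 2) :^ 2 :+ (b :^ 2 :+ con true) :=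
      (b :^ 2 :* h :+ h :^ 3) :* h) refl b ω)
    (*≈0ʳ _ ω²+ω+1≈0))))

  private
    relation₀ : ∀ {v w} → v * w ≈ 1# → v ^ᶠ 3 ≈ c → Rel ((0# + (v + w)) * 1#) ((0# + tr 1# v w) * 1#)
    relation₀ {v} {w} vw≈1 v³≈c = begin
      s * ((0# + (v + w)) * 1#) * ((0# + tr 1# v w) * 1# + 1#) ^ᶠ 2
        ≈⟨ solve 3 (λ s v w → let t = con true :* v :+ con true :^ 2 :* w in
           s :* ((con false :+ (v :+ w)) :* con true) :* ((con false :+ t) :* con true :+ con true) :^ 2 := s :* (t :^ 3 :+ t)) refl s v w ⟩
      s * (tr 1# v w ^ᶠ 3 + tr 1# v w) ≈⟨ *-congˡ (trans (tr-cubic unity-1 vw≈1) (+-cong v³≈c (cube-inverse vw≈1 v³≈c cc′≈1))) ⟩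
      s * (c + c′)                     ≈⟨ s[c+c′] ⟩
      1#                               ∎

    -- The two cubic hypotheses say that v³ = ω c; in the form s v² = (ω B + 1) w, s w² = (ω² B + 1) v they
    -- reduce the expanded relation to an identity in b and ω.
    relation₁ : ∀ {B v w β} → s ^ᶠ 2 ≈ B ^ᶠ 2 + B + 1# → v * w ≈ 1# →
      s * v ^ᶠ 3 ≈ ω * B + 1# → s * w ^ᶠ 3 ≈ ω ^ᶠ 2 * B + 1# → B * β ≈ 1# →
      Rel ((s + (v + w)) * β) ((s + tr ω v w) * β)
    relation₁ {B} {v} {w} {β} s²≈ vw≈1 sv³ sw³ Bβ≈1 = begin
      -- The summand 1 inside the square is B β, so that β³ can be factored out.
      s * ((s + (v + w)) * β) * ((s + t) * β + 1#) ^ᶠ 2 ≈⟨ *-congˡ (^-cong 2 (+≈0⇒≈ (trans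
        (solve 4 (λ s t β B → (s :+ t) :* β :+ con true :+ (s :+ t :+ B) :* β := B :* β :+ con true) refl s t β B) (≈⇒+≈0 Bβ≈1)))) ⟩
      s * ((s + (v + w)) * β) * ((s + t + B) * β) ^ᶠ 2
        ≈⟨ solve 5 (λ s X t B β → s :* ((s :+ X) :* β) :* ((s :+ t :+ B) :* β) :^ 2 := (s :* (s :+ X) :* (s :+ t :+ B) :^ 2) :* β :^ 3) refl s (v + w) t B β ⟩
      (s * (s + (v + w)) * (s + t + B) ^ᶠ 2) * β ^ᶠ 3   ≈⟨ *-congʳ (+≈0⇒≈ core) ⟩
      B ^ᶠ 3 * β ^ᶠ 3                                   ≈⟨ *-^ B β 3 ⟨
      (B * β) ^ᶠ 3                                      ≈⟨ ^-cong 3 Bβ≈1 ⟩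
      1# ^ᶠ 3                                           ≈⟨ 1^ 3 ⟩
      1#                                                ∎
      where
      t = tr ω v w
      square : ∀ {x y p} → x * y ≈ 1# → s * x ^ᶠ 3 ≈ p → s * x ^ᶠ 2 + p * y ≈ 0#
      square {x} {y} {p} xy≈1 eq = trans
        (solve 4 (λ s x y p → s :* x :^ 2 :+ p :* y := (s :* x :^ 2) :* (x :* y :+ con true) :+ y :* (s :* x :^ 3 :+ p)) refl s x y p)
        (*≈0ʳ _ (≈⇒+≈0 xy≈1) +≈0 *≈0ʳ _ (≈⇒+≈0 eq))
      core : s * (s + (v + w)) * (s + t + B) ^ᶠ 2 + B ^ᶠ 3 ≈ 0#
      core = trans
        (solve 5 (λ s v w B ω → s :* (s :+ (v :+ w)) :* (s :+ (ω :* v :+ ω :^ 2 :* w) :+ B) :^ 2 :+ B :^ 3 :=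
          (s :* ω :^ 2 :+ v :* ω :^ 2) :* (s :* v :^ 2 :+ (ω :* B :+ con true) :* w)
          :+ (s :* ω :+ w :* ω) :* (s :* w :^ 2 :+ (ω :^ 2 :* B :+ con true) :* v)
          :+ (s :* v :* ω :^ 2 :+ s :* w :* ω :^ 4 :+ ω :^ 2 :+ ω) :* (v :* w :+ con true)
          :+ (s :^ 2 :+ s :* v :+ s :* w :+ B :+ con true) :* (s :^ 2 :+ (B :^ 2 :+ B :+ con true))
          :+ (s :^ 2 :* w :^ 2 :* ω :^ 2 :+ s :^ 2 :* w :^ 2 :* ω :+ s :* v :* B :* ω :+ s :* v :* B :+ s :* v
            :+ s :* w :^ 3 :* ω :^ 2 :+ s :* w :^ 3 :* ω :+ s :* w :* B :* ω :+ s :* w :* B :+ s :* w :* ω :^ 2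
            :+ s :* w :* ω :+ s :* w :+ con true) :* (ω :^ 2 :+ (ω :+ con true))) refl s v w B ω)
        (*≈0ʳ _ (square vw≈1 sv³) +≈0 *≈0ʳ _ (square (trans (*-comm w v) vw≈1) sw³) +≈0 *≈0ʳ _ (≈⇒+≈0 vw≈1)
          +≈0 *≈0ʳ _ (≈⇒+≈0 s²≈) +≈0 *≈0ʳ _ ω²+ω+1≈0)

  -- `κ` is 1 for the fixed points and ω or ω² for the two 3-cycles, which it rotates. The values of
  -- `α` and `β` invert the substitutions X = x and X = x B + s, the latter for B = b² and then for
  -- b² + 1.
  family : Fin 3 → Family
  family zero = record
    { κ = 1# ; d = c ; d′ = c′ ; α = 0# ; β = 1# ; β′ = 1#
    ; κ-unity = unity-1 ; dd′≈1 = cc′≈1 ; d+d′≉0 = s[d+d′]≉0 s[c+c′] 1≉0 ; ββ′≈1 = *-identityʳ 1#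
    ; φα≈α = frob-0 m ; φβ≈β = φ-1 ; conj = c-conjugates ; relation = relation₀ }
  family (suc zero) = record
    { κ = ω ; d = ω * c ; d′ = ω ^ᶠ 2 * c′ ; α = s ; β = B ⁻¹ ; β′ = B
    ; κ-unity = ω³≈1 ; dd′≈1 = scaled-inverse ω³≈1 ; d+d′≉0 = s[d+d′]≉0 s[ωc+ω²c′] B≉0 ; ββ′≈1 = inverseˡ B B≉0
    ; φα≈α = φs≈s ; φβ≈β = φ-⁻¹ B≉0 φB≈B ; conj = scaled-conjugates ω³≈1
    ; relation = λ {v} {w} vw≈1 v³≈d → relation₁ s²-eq vw≈1
        (trans (*-congˡ v³≈d) (trans (s*scaled ω) (+≈0⇒≈ (trans
          (solve 2 (λ b ω → ω :* (b :+ ω) :^ 2 :+ (ω :* b :^ 2 :+ con true) := ω :^ 3 :+ con true) refl b ω) (≈⇒+≈0 ω³≈1)))))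
        (trans (*-congˡ (cube-inverse vw≈1 v³≈d (scaled-inverse ω³≈1))) (trans (s*scaled′ (ω ^ᶠ 2)) (+≈0⇒≈ (trans
          (solve 2 (λ b ω → ω :^ 2 :* (b :+ ω :^ 2) :^ 2 :+ (ω :^ 2 :* b :^ 2 :+ con true) := (ω :^ 3 :+ con true) :* (ω :^ 3 :+ con true)) refl b ω)
          (*≈0ʳ _ (≈⇒+≈0 ω³≈1))))))
        (inverseʳ B B≉0) }
  -- The substitution b ↦ b + 1, v ↦ v⁻¹ reduces this family to the previous one.
  family (suc (suc zero)) = record
    { κ = ω ^ᶠ 2 ; d = ω ^ᶠ 2 * c ; d′ = (ω ^ᶠ 2) ^ᶠ 2 * c′ ; α = s ; β = (B + 1#) ⁻¹ ; β′ = B + 1#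
    ; κ-unity = uω² ; dd′≈1 = scaled-inverse uω² ; d+d′≉0 = s[d+d′]≉0 s[ω²c+ωc′] B+1≉0
    ; ββ′≈1 = inverseˡ _ B+1≉0
    ; φα≈α = φs≈s ; φβ≈β = φ-⁻¹ B+1≉0 (φ-fixes-+ φB≈B φ-1) ; conj = scaled-conjugates uω²
    ; relation = λ {v} {w} vw≈1 v³≈d → Rel-cong
        (*-congʳ (+-congˡ (+-comm w v)))
        (*-congʳ (+-congˡ (trans (+-comm _ _) (+-congˡ (*-congʳ (trans (sym (unity-4 ω³≈1)) (^-* ω 2 2)))))))
        (relation₁ {B + 1#} (trans s²-eq (solve 1 (λ B → B :^ 2 :+ B :+ con true := (B :+ con true) :^ 2 :+ (B :+ con true) :+ con true) refl B))
          (trans (*-comm w v) vw≈1)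
          (trans (*-congˡ (cube-inverse vw≈1 v³≈d (scaled-inverse uω²))) (trans (s*scaled′ ((ω ^ᶠ 2) ^ᶠ 2)) (+≈0⇒≈ (trans
            (solve 2 (λ b ω → (ω :^ 2) :^ 2 :* (b :+ ω :^ 2) :^ 2 :+ (ω :* (b :^ 2 :+ con true) :+ con true) :=
              (b :^ 2 :* ω :+ ω :^ 2 :* (ω :^ 3 :+ con true)) :* (ω :^ 3 :+ con true) :+ (ω :^ 2 :+ (ω :+ con true))) refl b ω)
            (*≈0ʳ _ (≈⇒+≈0 ω³≈1) +≈0 ω²+ω+1≈0)))))
          (trans (*-congˡ v³≈d) (trans (s*scaled (ω ^ᶠ 2)) (+≈0⇒≈ (trans
            (solve 2 (λ b ω → ω :^ 2 :* (b :+ ω) :^ 2 :+ (ω :^ 2 :* (b :^ 2 :+ con true) :+ con true) :=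
              (ω :^ 2 :+ (ω :+ con true)) :* (ω :^ 2 :+ (ω :+ con true))) refl b ω)
            (*≈0ʳ _ ω²+ω+1≈0)))))
          (inverseʳ _ B+1≉0)) }
    where uω² = unity-^ 2 ω³≈1

-- Comparison of Γ with Λ₀, Λ₁ and Λ₂.

module Roots (ℓ m : ℕ) (m≥1 : 1 ≤ m) (F : GF2^ (6 *ℕ m))
  (a : GF2^.Carrier F) (φa≈a : FieldNotions.InF2^ F m a)
  (a≉0 : ¬ GF2^._≈_ F a (GF2^.0# F)) (a≉1 : ¬ GF2^._≈_ F a (GF2^.1# F))
  (ω : GF2^.Carrier F) (ω²≈ω+1 : GeneratesF₄ F ω)
  (b : GF2^.Carrier F) (φb≈b : FieldNotions.InF2^ F m b) (b-eq : ArtinSchreier F a b) where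
  open GF2^ F hiding (zero; distrib)
  open FieldNotions F
  open Families m m≥1 F a φa≈a a≉0 a≉1 ω ω²≈ω+1 b φb≈b b-eq public
  open Setup m ℓ a ω b using (q; Γ; Λ₀; Λ₁; Λ₂; Λ_) renaming (Λ to Λ₀₁₂)
  open import Relation.Binary.Reasoning.Setoid setoid
  open Family

  μ l : Fin 3
  μ = fromℕ< (m%n<n m 3)
  l = fromℕ< (m%n<n ℓ 3)

  toℕ-μ : toℕ μ ≡ m % 3
  toℕ-μ = toℕ-fromℕ< (m%n<n m 3)

  toℕ-l : toℕ l ≡ ℓ % 3
  toℕ-l = toℕ-fromℕ< (m%n<n ℓ 3)

  Λ⇒member : ∀ k {x} → Λ_ (toℕ k) x → Member (family k) x
  Λ⇒member zero (v , _ , v³ , x≈) = v , v ⁻¹ , root-unit (family zero) v³ , v³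
    , trans x≈ (sym (trans (*-identityʳ _) (+-identityˡ _)))
  Λ⇒member (suc zero) (v , _ , v³ , x≈) = v , v ⁻¹ , root-unit (family (suc zero)) v³ , v³
    , trans x≈ (*-congʳ (+-assoc _ _ _))
  Λ⇒member (suc (suc zero)) (v , _ , v³ , x≈) = v , v ⁻¹ , root-unit (family (suc (suc zero))) v³ , v³
    , trans x≈ (*-congʳ (+-assoc _ _ _))

  -- That `v` lies in F_{q⁶} is Fermat's theorem for the whole field, which has 2^(6m) elements.
  member⇒Λ : ∀ k {x} → Member (family k) x → Λ_ (toℕ k) x
  member⇒Λ zero (v , w , vw≈1 , v³ , x≈) = v , fermat v , v³
    , trans x≈ (trans (*-identityʳ _) (trans (+-identityˡ _) (+-congˡ (inverse-unique vw≈1))))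
  member⇒Λ (suc zero) (v , w , vw≈1 , v³ , x≈) = v , fermat v , v³
    , trans x≈ (*-congʳ (trans (+-congˡ (+-congˡ (inverse-unique vw≈1))) (sym (+-assoc _ _ _))))
  member⇒Λ (suc (suc zero)) (v , w , vw≈1 , v³ , x≈) = v , fermat v , v³
    , trans x≈ (*-congʳ (trans (+-congˡ (+-congˡ (inverse-unique vw≈1))) (sym (+-assoc _ _ _))))

  size3-resp : ∀ {P Q : Subset} → (∀ {x} → P x → Q x) → (∀ {x} → Q x → P x) → HasSize3 P → HasSize3 Q
  size3-resp P⊆Q Q⊆P (x , y , z , x≉y , x≉z , y≉z , P-cover) =
    x , y , z , x≉y , x≉z , y≉z , λ w → proj₁ (P-cover w) ∘ Q⊆P , P⊆Q ∘ proj₂ (P-cover w)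

  Λ-size3 : ∀ k → HasSize3 (Λ_ (toℕ k))
  Λ-size3 k = size3-resp (member⇒Λ k) (Λ⇒member k) (size3 (family k))

  private
    scaled-trace⇒member : ∀ k {x e} → s * (d (family k) + d′ (family k)) ≈ e →
      (let X = x * β′ (family k) + α (family k)) →
      s * (X ^ᶠ 3 + X) + e ≈ 0# → Member (family k) x
    scaled-trace⇒member k e≈ eq = cubic⇒member (family k) (*-cancelˡ s≉0 (trans (+≈0⇒≈ eq) (sym e≈)))

    member⇒scaled-trace : ∀ k {x e} → s * (d (family k) + d′ (family k)) ≈ e →
      (let X = x * β′ (family k) + α (family k)) →
      Member (family k) x → s * (X ^ᶠ 3 + X) + e ≈ 0#
    member⇒scaled-trace k e≈ mem = ≈⇒+≈0 (trans (*-congˡ (member⇒cubic (family k) mem)) e≈)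

    s²-eq′ : s ^ᶠ 2 ≈ (B + 1#) ^ᶠ 2 + (B + 1#) + 1#
    s²-eq′ = trans s²-eq (solve 1 (λ B → B :^ 2 :+ B :+ con true := (B :+ con true) :^ 2 :+ (B :+ con true) :+ con true) refl B)

    cubic₀⇒member : ∀ {x} → Cubic₀ x ≈ 0# → Member (family zero) x
    cubic₀⇒member {x} p = scaled-trace⇒member zero s[c+c′] (trans (Cubic₀-trace x) p)

    cubic₁⇒member : ∀ {x} → Cubic B x ≈ 0# → Member (family (suc zero)) x
    cubic₁⇒member {x} p = scaled-trace⇒member (suc zero) s[ωc+ω²c′] (trans (Cubic-trace B x s²-eq) (*≈0ʳ _ p))

    cubic₂⇒member : ∀ {x} → Cubic (B + 1#) x ≈ 0# → Member (family (suc (suc zero))) x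
    cubic₂⇒member {x} p = scaled-trace⇒member (suc (suc zero)) s[ω²c+ωc′] (trans (Cubic-trace (B + 1#) x s²-eq′) (*≈0ʳ _ p))

    member⇒cubic₁ : ∀ {x} → Member (family (suc zero)) x → Cubic B x ≈ 0#
    member⇒cubic₁ {x} mem = [ (λ p → contradiction p (^≉0 2 B≉0)) , (λ p → p) ]′
      (*≈0 (trans (sym (Cubic-trace B x s²-eq)) (member⇒scaled-trace (suc zero) s[ωc+ω²c′] mem)))

    member⇒cubic₂ : ∀ {x} → Member (family (suc (suc zero))) x → Cubic (B + 1#) x ≈ 0#
    member⇒cubic₂ {x} mem = [ (λ p → contradiction p (^≉0 2 B+1≉0)) , (λ p → p) ]′
      (*≈0 (trans (sym (Cubic-trace (B + 1#) x s²-eq′)) (member⇒scaled-trace (suc (suc zero)) s[ω²c+ωc′] mem)))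

    member₀⇒Rel : ∀ {x} → Member (family zero) x → Rel x x
    member₀⇒Rel (v , w , vw≈1 , v³≈d , x≈) =
      Rel-cong (sym x≈) (trans (point-1 (family zero) v w) (sym x≈)) (relation (family zero) vw≈1 v³≈d)

  -- Points of Λ₀ are their own successors, while κ = ω moves every point of Λ₁.
  disjoint₀₁ : Disjoint Λ₀ Λ₁
  disjoint₀₁ x (x∈Λ₀ , x∈Λ₁) =
    ω≉1 (Rel-diagonal (family (suc zero)) (Λ⇒member (suc zero) x∈Λ₁) (member₀⇒Rel (Λ⇒member zero x∈Λ₀)))

  disjoint₀₂ : Disjoint Λ₀ Λ₂
  disjoint₀₂ x (x∈Λ₀ , x∈Λ₂) =
    ω²≉1 (Rel-diagonal (family (suc (suc zero))) (Λ⇒member (suc (suc zero)) x∈Λ₂) (member₀⇒Rel (Λ⇒member zero x∈Λ₀)))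

  -- The cubics of Λ₁ and Λ₂ add up to that of Λ₀.
  disjoint₁₂ : Disjoint Λ₁ Λ₂
  disjoint₁₂ x (x∈Λ₁ , x∈Λ₂) = disjoint₀₁ x (member⇒Λ zero (cubic₀⇒member (trans (sym (Cubic-+ B x))
    (member⇒cubic₁ (Λ⇒member (suc zero) x∈Λ₁) +≈0 member⇒cubic₂ (Λ⇒member (suc (suc zero)) x∈Λ₂)))) , x∈Λ₁)

  private
    cube-exponent : (2 ^ℕ m) ^ℕ 3 ≡ 2 ^ℕ (3 *ℕ m)
    cube-exponent = ≡.trans (ℕ.^-*-assoc 2 m 3) (≡.cong (2 ^ℕ_) (ℕ.*-comm m 3))

  Γ⇒Rel : ∀ {x} → Γ x → Rel x (Φ ℓ x)
  Γ⇒Rel (_ , root) = root⇒Rel ℓ root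

  abstract
    Γ⇒Λ : ∀ {x} → Γ x → ∃ λ (k : Fin 3) → Λ_ (toℕ k) x
    Γ⇒Λ {x} x∈Γ@(x-fixed , _) = [ (λ p → zero , member⇒Λ zero (cubic₀⇒member p))
      , [ (λ p → suc zero , member⇒Λ (suc zero) (cubic₁⇒member p))
        , (λ p → suc (suc zero) , member⇒Λ (suc (suc zero)) (cubic₂⇒member p)) ]′ ]′
      (cycle⇒cubic B s²-eq xy yz (Rel-cong refl zx≈x (Rel-Φ ℓ yz)))
      where
      xy : Rel x (Φ ℓ x)
      xy = Γ⇒Rel x∈Γ
      yz : Rel (Φ ℓ x) (Φ ℓ (Φ ℓ x))
      yz = Rel-Φ ℓ xy
      Φ3x : Φ 3 x ≈ x
      Φ3x = trans (reflexive (≡.cong (x ^ᶠ_) cube-exponent)) x-fixed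
      zx≈x : Φ ℓ (Φ ℓ (Φ ℓ x)) ≈ x
      zx≈x = begin
        Φ ℓ (Φ ℓ (Φ ℓ x))          ≈⟨ Φ-+ℕ ℓ ℓ (Φ ℓ x) ⟨
        Φ (ℓ +ℕ ℓ) (Φ ℓ x)         ≈⟨ Φ-+ℕ ℓ (ℓ +ℕ ℓ) x ⟨
        Φ (ℓ +ℕ (ℓ +ℕ ℓ)) x        ≡⟨ ≡.cong (λ j → Φ j x) (≡.trans (≡.cong (λ j → ℓ +ℕ (ℓ +ℕ j)) (≡.sym (ℕ.+-identityʳ ℓ))) (ℕ.*-comm 3 ℓ)) ⟩
        Φ (ℓ *ℕ 3) x               ≈⟨ Φ-multiple 3 ℓ Φ3x ⟩
        x                          ∎

    c-character : ∃ λ (ρ : Fin 3) → c ^ᶠ repunit m ≈ ω ^ᶠ toℕ ρ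
    c-character = [ (λ p → zero , p) , [ (λ p → suc zero , trans p (sym (x^1 ω))) , (λ p → suc (suc zero) , p) ]′ ]′
      (unity-cases (ζ-unity (family zero)))

  ρ : Fin 3
  ρ = proj₁ c-character

  family-κ : ∀ k → κ (family k) ≈ ω ^ᶠ toℕ k
  family-κ zero             = refl
  family-κ (suc zero)       = sym (x^1 ω)
  family-κ (suc (suc zero)) = refl

  family-d : ∀ k → d (family k) ≈ ω ^ᶠ toℕ k * c
  family-d zero             = sym (*-identityˡ c)
  family-d (suc zero)       = *-congʳ (sym (x^1 ω))
  family-d (suc (suc zero)) = refl

  -- Since ω^((4^m - 1)/3) = ω^m, passing from c to ω^k c adds k m to the exponent of the cubic
  -- character.
  family-ζ : ∀ k → ζ (family k) ≈ ω ^ᶠ (toℕ k *ℕ toℕ μ +ℕ toℕ ρ)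
  family-ζ k = begin
    d (family k) ^ᶠ r                 ≈⟨ ^-cong r (family-d k) ⟩
    (ω ^ᶠ toℕ k * c) ^ᶠ r             ≈⟨ *-^ _ c r ⟩
    (ω ^ᶠ toℕ k) ^ᶠ r * c ^ᶠ r        ≈⟨ *-cong ω^k-character (proj₂ c-character) ⟩
    ω ^ᶠ (toℕ k *ℕ toℕ μ) * ω ^ᶠ toℕ ρ ≈⟨ ^-+ ω (toℕ k *ℕ toℕ μ) (toℕ ρ) ⟨
    ω ^ᶠ (toℕ k *ℕ toℕ μ +ℕ toℕ ρ)    ∎
    where
    r = repunit m
    ω^k-character : (ω ^ᶠ toℕ k) ^ᶠ r ≈ ω ^ᶠ (toℕ k *ℕ toℕ μ)
    ω^k-character = begin
      (ω ^ᶠ toℕ k) ^ᶠ r       ≈⟨ ^-* ω (toℕ k) r ⟨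
      ω ^ᶠ (toℕ k *ℕ r)       ≡⟨ ≡.cong (ω ^ᶠ_) (ℕ.*-comm (toℕ k) r) ⟩
      ω ^ᶠ (r *ℕ toℕ k)       ≈⟨ ^-* ω r (toℕ k) ⟩
      (ω ^ᶠ r) ^ᶠ toℕ k       ≈⟨ ^-cong (toℕ k) (trans (ω^repunit m) (trans (unity-% m ω³≈1) (reflexive (≡.cong (ω ^ᶠ_) (≡.sym toℕ-μ))))) ⟩
      (ω ^ᶠ toℕ μ) ^ᶠ toℕ k   ≈⟨ ^-* ω (toℕ μ) (toℕ k) ⟨
      ω ^ᶠ (toℕ μ *ℕ toℕ k)   ≡⟨ ≡.cong (ω ^ᶠ_) (ℕ.*-comm (toℕ μ) (toℕ k)) ⟩
      ω ^ᶠ (toℕ k *ℕ toℕ μ)   ∎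

  ^ℓ≈^l : ∀ {e} → Unity e → e ^ᶠ ℓ ≈ e ^ᶠ toℕ l
  ^ℓ≈^l {e} ue = trans (unity-% ℓ ue) (reflexive (≡.cong (e ^ᶠ_) (≡.sym toℕ-l)))

  toℕ%3 : ∀ (k : Fin 3) → toℕ k % 3 ≡ toℕ k
  toℕ%3 k = m<n⇒m%n≡m (toℕ<n k)

  ζ-power : ∀ k → (ζ (family k) ^ᶠ 2) ^ᶠ ℓ ≈ ω ^ᶠ ((toℕ k *ℕ toℕ μ +ℕ toℕ ρ) *ℕ 2 *ℕ toℕ l)
  ζ-power k = begin
    (ζ (family k) ^ᶠ 2) ^ᶠ ℓ       ≈⟨ ^ℓ≈^l (unity-^ 2 (ζ-unity (family k))) ⟩
    (ζ (family k) ^ᶠ 2) ^ᶠ toℕ l   ≈⟨ ^-cong (toℕ l) (^-cong 2 (family-ζ k)) ⟩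
    ((ω ^ᶠ i) ^ᶠ 2) ^ᶠ toℕ l       ≈⟨ ^-cong (toℕ l) (^-* ω i 2) ⟨
    (ω ^ᶠ (i *ℕ 2)) ^ᶠ toℕ l       ≈⟨ ^-* ω (i *ℕ 2) (toℕ l) ⟨
    ω ^ᶠ (i *ℕ 2 *ℕ toℕ l)         ∎
    where i = toℕ k *ℕ toℕ μ +ℕ toℕ ρ

  selected⇒selects : ∀ k → Selected (family k) ℓ → Selects l μ ρ k
  selected⇒selects k sel = ≡.trans (ω^-injective ((toℕ k *ℕ toℕ μ +ℕ toℕ ρ) *ℕ 2 *ℕ toℕ l) (toℕ k) (trans (sym (ζ-power k)) (trans sel (family-κ k)))) (toℕ%3 k)

  selects⇒selected : ∀ k → Selects l μ ρ k → Selected (family k) ℓ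
  selects⇒selected k sel = trans (ζ-power k) (trans (ω^-cong ((toℕ k *ℕ toℕ μ +ℕ toℕ ρ) *ℕ 2 *ℕ toℕ l) (toℕ k) (≡.trans sel (≡.sym (toℕ%3 k)))) (sym (family-κ k)))

  Λ∩Γ⇒selects : ∀ k {x} → Λ_ (toℕ k) x → Γ x → Selects l μ ρ k
  Λ∩Γ⇒selects k x∈Λ x∈Γ = selected⇒selects k (Rel⇒selected (family k) ℓ (Λ⇒member k x∈Λ) (Γ⇒Rel x∈Γ))

  selects⇒Λ⊆Γ : ∀ k {x} → Selects l μ ρ k → Λ_ (toℕ k) x → Γ x
  selects⇒Λ⊆Γ k {x} sel x∈Λ =
      trans (reflexive (≡.cong (x ^ᶠ_) (≡.sym cube-exponent))) (member-fixed (family k) (Λ⇒member k x∈Λ))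
    , Rel⇒root ℓ (selected⇒Rel (family k) ℓ (selects⇒selected k sel) (Λ⇒member k x∈Λ))

  -- `Λ_` is empty beyond index 2, so a point of it bounds the index. This allows indices given as
  -- natural numbers, such as 3 - k.
  Λ-index : ∀ k {x} → Λ_ k x → ∃ λ (j : Fin 3) → toℕ j ≡ k
  Λ-index 0 _ = zero , ≡.refl
  Λ-index 1 _ = suc zero , ≡.refl
  Λ-index 2 _ = suc (suc zero) , ≡.refl

  selectsOnly⇒Γ≐Λ : ∀ k → SelectsOnly l μ ρ k → Γ ≐ (Λ_ k)
  selectsOnly⇒Γ≐Λ k only x = to , from
    where
    to : Γ x → Λ_ k x
    to x∈Γ = let j , x∈Λ = Γ⇒Λ {x} x∈Γ in ≡.subst (λ i → Λ_ i x) (proj₁ (only j) (Λ∩Γ⇒selects j {x} x∈Λ x∈Γ)) x∈Λ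
    from : Λ_ k x → Γ x
    from x∈Λ = let j , j≡k = Λ-index k {x} x∈Λ in
      selects⇒Λ⊆Γ j {x} (proj₂ (only j) j≡k) (≡.subst (λ i → Λ_ i x) (≡.sym j≡k) x∈Λ)

  selectsAll⇒Γ≐Λ : (∀ j → Selects l μ ρ j) → Γ ≐ Λ₀₁₂
  selectsAll⇒Γ≐Λ all x = to ∘ Γ⇒Λ {x} , from
    where
    to : (∃ λ (k : Fin 3) → Λ_ (toℕ k) x) → Λ₀₁₂ x
    to (zero , x∈Λ)           = inj₁ (inj₁ x∈Λ)
    to (suc zero , x∈Λ)       = inj₁ (inj₂ x∈Λ)
    to (suc (suc zero) , x∈Λ) = inj₂ x∈Λ
    from : Λ₀₁₂ x → Γ x
    from (inj₁ (inj₁ x∈Λ)) = selects⇒Λ⊆Γ zero {x} (all zero) x∈Λ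
    from (inj₁ (inj₂ x∈Λ)) = selects⇒Λ⊆Γ (suc zero) {x} (all (suc zero)) x∈Λ
    from (inj₂ x∈Λ)        = selects⇒Λ⊆Γ (suc (suc zero)) {x} (all (suc (suc zero))) x∈Λ

  selectsNone⇒Γ≐∅ : (∀ j → ¬ Selects l μ ρ j) → Γ ≐ Empty
  selectsNone⇒Γ≐∅ none x = (λ x∈Γ → let j , x∈Λ = Γ⇒Λ {x} x∈Γ in none j (Λ∩Γ⇒selects j {x} x∈Λ x∈Γ)) , λ ()

  -- Cubes in F_{q²} and the exponents of the cubic character.

  private
    φφ-subfield : ∀ y → φ (φ y) ≈ y ^ᶠ (2 ^ℕ (2 *ℕ m))
    φφ-subfield y = trans (φφ y) (reflexive (≡.cong (y ^ᶠ_) (ℕ.^-*-assoc 2 2 m)))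

  -- F_{q²} is the fixed field of φ ∘ φ, which multiplies each cube root of d = ω^k c by ζ. So d is
  -- a cube there exactly when ζ = 1; this lemma and the next are the two directions.
  cube⇒exponent : ∀ k → IsCubeIn (2 *ℕ m) (ω ^ᶠ toℕ k * c) → (toℕ k *ℕ toℕ μ +ℕ toℕ ρ) % 3 ≡ 0
  cube⇒exponent k (y , y-fixed , y³) = ω^-injective (toℕ k *ℕ toℕ μ +ℕ toℕ ρ) 0 (trans (sym (family-ζ k))
    (cube⇒ζ≈1 (family k) (trans (φφ-subfield y) y-fixed) (trans y³ (sym (family-d k)))))

  exponent⇒cube : ∀ k → (toℕ k *ℕ toℕ μ +ℕ toℕ ρ) % 3 ≡ 0 → IsCubeIn (2 *ℕ m) (ω ^ᶠ toℕ k * c)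
  exponent⇒cube k eq = proj₁ (cube-root (family k)) , (begin
      v ^ᶠ (2 ^ℕ (2 *ℕ m))   ≈⟨ φφ-subfield v ⟨
      φ (φ v)                ≈⟨ cube-root-conjugate (family k) ⟩
      ζ (family k) * v       ≈⟨ *-congʳ (trans (family-ζ k) (ω^-cong (toℕ k *ℕ toℕ μ +ℕ toℕ ρ) 0 eq)) ⟩
      1# * v                 ≈⟨ *-identityˡ v ⟩
      v                      ∎)
    , trans (proj₂ (cube-root (family k))) (family-d k)
    where v = proj₁ (cube-root (family k))

  c-cube⇒ρ≡0 : IsCubeIn (2 *ℕ m) c → toℕ ρ % 3 ≡ 0
  c-cube⇒ρ≡0 (y , y-fixed , y³) = cube⇒exponent zero (y , y-fixed , trans y³ (sym (*-identityˡ c)))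

  ρ≡0⇒c-cube : toℕ ρ % 3 ≡ 0 → IsCubeIn (2 *ℕ m) c
  ρ≡0⇒c-cube eq = Product.map₂ (Product.map₂ λ y³ → trans y³ (*-identityˡ c)) (exponent⇒cube zero eq)

  private
    exponent≡repunit : (q ^ℕ 2 ∸ 1) / 3 ≡ repunit m
    exponent≡repunit = ≡.trans (≡.cong (λ N → (N ∸ 1) / 3) (≡.trans ([2^k]²≡4^k m) (≡.sym (repunit-*3 m)))) (m*n/n≡m (repunit m) 3)

    c-exponent : c ^ᶠ ((q ^ℕ 2 ∸ 1) / 3) ≈ ω ^ᶠ toℕ ρ
    c-exponent = trans (reflexive (≡.cong (c ^ᶠ_) exponent≡repunit)) (proj₂ c-character)

    -- The power ω^(-kℓ) is written with ω² in place of ω⁻¹, which keeps all exponents natural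
    -- numbers.
    ω^2kℓ : ∀ k → (ω ^ᶠ 2) ^ᶠ (k *ℕ ℓ) ≈ ω ^ᶠ (2 *ℕ (k *ℕ toℕ l))
    ω^2kℓ k = begin
      (ω ^ᶠ 2) ^ᶠ (k *ℕ ℓ)        ≈⟨ ^-* (ω ^ᶠ 2) k ℓ ⟩
      ((ω ^ᶠ 2) ^ᶠ k) ^ᶠ ℓ        ≈⟨ ^ℓ≈^l (unity-^ k (unity-^ 2 ω³≈1)) ⟩
      ((ω ^ᶠ 2) ^ᶠ k) ^ᶠ toℕ l    ≈⟨ ^-* (ω ^ᶠ 2) k (toℕ l) ⟨
      (ω ^ᶠ 2) ^ᶠ (k *ℕ toℕ l)    ≈⟨ ^-* ω 2 (k *ℕ toℕ l) ⟨
      ω ^ᶠ (2 *ℕ (k *ℕ toℕ l))    ∎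

  exponent⇒character : ∀ k → toℕ ρ % 3 ≡ (2 *ℕ (k *ℕ toℕ l)) % 3 → c ^ᶠ ((q ^ℕ 2 ∸ 1) / 3) ≈ (ω ^ᶠ 2) ^ᶠ (k *ℕ ℓ)
  exponent⇒character k eq = trans c-exponent (trans (ω^-cong (toℕ ρ) (2 *ℕ (k *ℕ toℕ l)) eq) (sym (ω^2kℓ k)))

  character⇒exponent : ∀ k → c ^ᶠ ((q ^ℕ 2 ∸ 1) / 3) ≈ (ω ^ᶠ 2) ^ᶠ (k *ℕ ℓ) → toℕ ρ % 3 ≡ (2 *ℕ (k *ℕ toℕ l)) % 3
  character⇒exponent k eq = ω^-injective (toℕ ρ) (2 *ℕ (k *ℕ toℕ l)) (trans (sym c-exponent) (trans eq (ω^2kℓ k)))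

  3∣⇒μ≡0 : 3 ∣ m → toℕ μ ≡ 0
  3∣⇒μ≡0 3∣m = ≡.trans toℕ-μ (n∣m⇒m%n≡0 m 3 3∣m)

  3∤⇒μ≢0 : ¬ (3 ∣ m) → toℕ μ ≢ 0
  3∤⇒μ≢0 3∤m μ≡0 = 3∤m (m%n≡0⇒n∣m m 3 (≡.trans (≡.sym toℕ-μ) μ≡0))

  3∤⇒l≢0 : ¬ (3 ∣ ℓ) → toℕ l ≢ 0
  3∤⇒l≢0 3∤ℓ l≡0 = 3∤ℓ (m%n≡0⇒n∣m ℓ 3 (≡.trans (≡.sym toℕ-l) l≡0))

  ≡⇒l≡μ : ℓ % 3 ≡ m % 3 → toℕ l ≡ toℕ μ
  ≡⇒l≡μ eq = ≡.trans toℕ-l (≡.trans eq (≡.sym toℕ-μ))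

  3∣⇒l+μ≡0 : 3 ∣ (ℓ +ℕ m) → (toℕ l +ℕ toℕ μ) % 3 ≡ 0
  3∣⇒l+μ≡0 3∣ℓ+m = ≡.trans (≡.cong₂ (λ i j → (i +ℕ j) % 3) toℕ-l toℕ-μ)
    (≡.trans (≡.sym (%-distribˡ-+ ℓ m 3)) (n∣m⇒m%n≡0 (ℓ +ℕ m) 3 3∣ℓ+m))

  -- The cases of the theorem.

  case-cube : 3 ∣ m → IsCubeIn (2 *ℕ m) c → Γ ≐ Λ₀
  case-cube 3∣m cube = selectsOnly⇒Γ≐Λ 0 (selection-cube l μ ρ (3∣⇒μ≡0 3∣m) (c-cube⇒ρ≡0 cube))

  private
    nonzero⇒1⊎2 : ∀ (k : Fin 3) → toℕ k ≢ 0 → toℕ k ≡ 1 ⊎ toℕ k ≡ 2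
    nonzero⇒1⊎2 zero             k≢0 = contradiction ≡.refl k≢0
    nonzero⇒1⊎2 (suc zero)       _   = inj₁ ≡.refl
    nonzero⇒1⊎2 (suc (suc zero)) _   = inj₂ ≡.refl

  case-noncube : ¬ (3 ∣ ℓ) → 3 ∣ m → ¬ IsCubeIn (2 *ℕ m) c →
    Σ ℕ λ k → (k ≡ 1 ⊎ k ≡ 2)
      × c ^ᶠ ((q ^ℕ 2 ∸ 1) / 3) ≈ (ω ^ᶠ 2) ^ᶠ (k *ℕ ℓ)
      × (∀ k′ → (k′ ≡ 1 ⊎ k′ ≡ 2) → c ^ᶠ ((q ^ℕ 2 ∸ 1) / 3) ≈ (ω ^ᶠ 2) ^ᶠ (k′ *ℕ ℓ) → k′ ≡ k)
      × (Γ ≐ (Λ_ k))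
  case-noncube 3∤ℓ 3∣m noncube =
    let k , k≢0 , exponent , unique , only = selection-noncube l μ ρ (3∤⇒l≢0 3∤ℓ) (3∣⇒μ≡0 3∣m) (noncube ∘ ρ≡0⇒c-cube) in
    toℕ k , nonzero⇒1⊎2 k k≢0 , exponent⇒character (toℕ k) exponent
    , (λ { .1 (inj₁ ≡.refl) eq → unique (suc zero) (λ ()) (character⇒exponent 1 eq)
         ; .2 (inj₂ ≡.refl) eq → unique (suc (suc zero)) (λ ()) (character⇒exponent 2 eq) })
    , selectsOnly⇒Γ≐Λ (toℕ k) only

  case-3∤m : ¬ (3 ∣ m) →
    Σ ℕ λ k → k < 3
      × IsCubeIn (2 *ℕ m) (ω ^ᶠ k * c)
      × (∀ k′ → k′ < 3 → IsCubeIn (2 *ℕ m) (ω ^ᶠ k′ * c) → k′ ≡ k)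
      × (k ≡ 0 → ℓ % 3 ≡ m % 3 → Γ ≐ Λ₀)
      × (k ≢ 0 → ℓ % 3 ≡ m % 3 → Γ ≐ (Λ_ (3 ∸ k)))
      × (k ≡ 0 → 3 ∣ (ℓ +ℕ m) → Γ ≐ Λ₀₁₂)
      × (k ≢ 0 → 3 ∣ (ℓ +ℕ m) → Γ ≐ Empty)
  case-3∤m 3∤m =
    let k , exponent , unique , same₀ , same , opposite₀ , opposite = selection-3∤m l μ ρ (3∤⇒μ≢0 3∤m) in
    toℕ k , toℕ<n k , exponent⇒cube k exponent
    , (λ k′ k′<3 cube → ≡.trans (≡.sym (toℕ-fromℕ< k′<3))
        (unique (fromℕ< k′<3) (cube⇒exponent (fromℕ< k′<3) (≡.subst (λ i → IsCubeIn (2 *ℕ m) (ω ^ᶠ i * c)) (≡.sym (toℕ-fromℕ< k′<3)) cube))))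
    , (λ k≡0 eq → selectsOnly⇒Γ≐Λ 0 (same₀ k≡0 (≡⇒l≡μ eq)))
    , (λ k≢0 eq → selectsOnly⇒Γ≐Λ (3 ∸ toℕ k) (same k≢0 (≡⇒l≡μ eq)))
    , (λ k≡0 3∣ℓ+m → selectsAll⇒Γ≐Λ (opposite₀ k≡0 (3∣⇒l+μ≡0 3∣ℓ+m)))
    , (λ k≢0 3∣ℓ+m → selectsNone⇒Γ≐∅ (opposite k≢0 (3∣⇒l+μ≡0 3∣ℓ+m)))

theorem1p3 : (ℓ m : ℕ) → ℓ ≥ 1 → m ≥ 1 → ¬ (3 ∣ ℓ) →
    (F : GF2^ (6 *ℕ m)) →
    let open GF2^ F in
    let open FieldNotions F in
    (a : Carrier) → InF2^ m a → ¬ (a ≈ 0#) → ¬ (a ≈ 1#) →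
    Tr m (a ⁻¹) ≈ Tr m 1# →
    (ω : Carrier) → InF2^ 2 ω → ¬ (ω ≈ 0#) → ¬ (ω ≈ 1#) →
    (b : Carrier) → InF2^ m b → ((b ^ᶠ 2) + b) ≈ (a ⁻¹ + 1#) →
    let open Setup m ℓ a ω b in
    ¬ InF2^ 2 b
    × (HasSize3 Λ₀ × HasSize3 Λ₁ × HasSize3 Λ₂)
    × (Disjoint Λ₀ Λ₁ × Disjoint Λ₀ Λ₂ × Disjoint Λ₁ Λ₂)
    × (3 ∣ m → IsCubeIn (2 *ℕ m) c → Γ ≐ Λ₀)
    × (3 ∣ m → ¬ IsCubeIn (2 *ℕ m) c →
    Σ ℕ (λ k → (k ≡ 1 ⊎ k ≡ 2)
    × ((c ^ᶠ ((q ^ℕ 2 ∸ 1) / 3)) ≈ ((ω ^ᶠ 2) ^ᶠ (k *ℕ ℓ)))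
    × (∀ k′ → (k′ ≡ 1 ⊎ k′ ≡ 2) → (c ^ᶠ ((q ^ℕ 2 ∸ 1) / 3)) ≈ ((ω ^ᶠ 2) ^ᶠ (k′ *ℕ ℓ)) → k′ ≡ k)
    × (Γ ≐ (Λ_ k))))
    × (¬ (3 ∣ m) →
    Σ ℕ (λ k → k < 3
    × IsCubeIn (2 *ℕ m) ((ω ^ᶠ k) * c)
    × (∀ k′ → k′ < 3 → IsCubeIn (2 *ℕ m) ((ω ^ᶠ k′) * c) → k′ ≡ k)
    × (k ≡ 0 → ℓ % 3 ≡ m % 3 → Γ ≐ Λ₀)
    × (k ≢ 0 → ℓ % 3 ≡ m % 3 → Γ ≐ (Λ_ (3 ∸ k)))
    × (k ≡ 0 → 3 ∣ (ℓ +ℕ m) → Γ ≐ Λ)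
    × (k ≢ 0 → 3 ∣ (ℓ +ℕ m) → Γ ≐ Empty)))
theorem1p3 ℓ m _ m≥1 3∤ℓ F a φa≈a a≉0 a≉1 _ ω ω⁴≈ω ω≉0 ω≉1 b φb≈b b-eq =
  b∉F₄ , (Λ-size3 zero , Λ-size3 (suc zero) , Λ-size3 (suc (suc zero))) , (disjoint₀₁ , disjoint₀₂ , disjoint₁₂)
  , case-cube , case-noncube 3∤ℓ , case-3∤m
  where
  open Roots ℓ m m≥1 F a φa≈a a≉0 a≉1
    ω (F₄-generator F (ℕ.≤-trans m≥1 (ℕ.m≤m+n m _)) ω⁴≈ω ω≉0 ω≉1) b φb≈b b-eq
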